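{- For every integer $n\geq1$, $N_o^+(n)=G(n)$, where $N_o^+(n)$ is the number of partitions of $n$ whose rank is positive and odd, and $G(n)$ is the number of partitions of $n$ into parts of two colors (red and blue) such that the smallest part is even, say equal to $2m$, and every red part is even and lies in the interval $(2m,4m]$.
   Context: The rank of a partition is its largest part minus its number of parts. In the two-color partitions counted by $G(n)$, parts of different colors are distinguished and the order of parts is irrelevant; blue parts are unrestricted apart from being at least the smallest part. For example $G(8)=7$, counting $8_b,\ 6_b+2_b,\ 4_b+4_b,\ 4_b+2_b+2_b,\ 2_b+2_b+2_b+2_b,\ 3_b+3_b+2_b,\ 4_r+2_b+2_b$. Equivalently, $\sum_{n\ge1}G(n)q^n=\sum_{m=1}^\infty\frac{q^{2m}}{(q^{2m+2};q^2)_m(q^{2m};q)_\infty}$, with $(A;q)_N=\prod_{j=0}^{N-1}(1-Aq^j)$ and $(A;q)_\infty=\prod_{j\ge0}(1-Aq^j)$. -}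

module Defs where

open import Data.Nat using (ℕ; zero; suc; _+_; _*_; _∸_; _≤_; _<_; _≤?_; _<?_)
open import Data.Nat using (_⊓_; _/_)
open import Data.Nat.Properties using (_≟_; *-comm)
open import Data.Nat.DivMod using (_%_; m*n%n≡0; m≡m%n+[m/n]*n; m*n/n≡m)
open import Relation.Binary.PropositionalEquality using (_≡_; refl; sym; trans; cong; subst)
open import Data.List using (List; []; _∷_; length; filter; concatMap; map; sum; upTo; applyUpTo)
open import Data.List.Relation.Unary.All using (All)
open import Data.List.Relation.Unary.All using (all?)
open import Data.Product using (_×_; _,_; Σ)
open import Relation.Nullary using (Dec; yes; no; ¬_)
open import Relation.Nullary.Decidable using (_×-dec_)
open import Relation.Unary using (Decidable)

-- A partition is represented as a list of parts in NON-INCREASING order,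
-- each part ≥ 1.

partsLE : ℕ → ℕ → List (List ℕ)
partsLE b n = go n b n
  where
  -- fuel f ≥ n guarantees termination
  go : ℕ → ℕ → ℕ → List (List ℕ)
  go f       b zero    = [] ∷ []
  go zero    b (suc n) = []
  go (suc f) b (suc n) =
    concatMap (λ k → map (λ p → suc k ∷ p) (go f (suc k) (suc n ∸ suc k)))
              (filter (λ k → suc k ≤? b) (upTo (suc n)))

partitions : ℕ → List (List ℕ)
partitions n = partsLE n n

largest : List ℕ → ℕ
largest []      = 0
largest (x ∷ _) = x

smallest : List ℕ → ℕ
smallest []           = 0
smallest (x ∷ [])     = x
smallest (_ ∷ y ∷ ys) = smallest (y ∷ ys)

PosOddRank : List ℕ → Set
PosOddRank p = (length p < largest p) × ((largest p ∸ length p) % 2 ≡ 1)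

posOddRank? : Decidable PosOddRank
posOddRank? p = (length p <? largest p) ×-dec ((largest p ∸ length p) % 2 ≟ 1)

NoPlus : ℕ → ℕ
NoPlus n = length (filter posOddRank? (partitions n))

-- Two-colour partitions of n: pairs (blue , red) of partitions (each a
-- non-increasing list of positive parts) with |blue| + |red| = n.
-- Each pair is listed exactly once: choose the red total r ∈ [0, n].
twoColour : ℕ → List (List ℕ × List ℕ)
twoColour n =
  concatMap (λ r → concatMap (λ red → map (λ blue → blue , red) (partitions (n ∸ r)))
                             (partitions r))
            (upTo (suc n))

smallest2 : List ℕ × List ℕ → ℕ
smallest2 ([] , red)        = smallest red
smallest2 (blue , [])       = smallest blue
smallest2 (b ∷ bs , r ∷ rs) = smallest (b ∷ bs) ⊓ smallest (r ∷ rs)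

-- The G-condition: the partition is nonempty, its smallest part is even,
-- say 2m (with m ≥ 1 since parts are positive), and every red part is
-- even and lies in (2m, 4m].
GCond : List ℕ × List ℕ → Set
GCond (blue , red) =
  Σ ℕ λ m → (1 ≤ m) × (smallest2 (blue , red) ≡ 2 * m) ×
    All (λ x → (x % 2 ≡ 0) × (2 * m < x) × (x ≤ 4 * m)) red

gCond? : Decidable GCond
gCond? (blue , red) with smallest2 (blue , red) % 2 ≟ 0
... | no odd = no λ { (m , _ , eq , _) → odd (trans (cong (_% 2) eq) (lem m)) }
  where lem : ∀ m → (2 * m) % 2 ≡ 0
        lem m = trans (cong (_% 2) (*-comm 2 m)) (m*n%n≡0 m 2)
... | yes ev with 1 ≤? smallest2 (blue , red) / 2
                | all? (λ x → (x % 2 ≟ 0) ×-dec ((2 * (smallest2 (blue , red) / 2) <? x)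
                                              ×-dec (x ≤? 4 * (smallest2 (blue , red) / 2)))) red
...   | yes m≥1 | yes ok = yes (smallest2 (blue , red) / 2 , m≥1 , half , ok)
  where half : smallest2 (blue , red) ≡ 2 * (smallest2 (blue , red) / 2)
        half = trans (m≡m%n+[m/n]*n (smallest2 (blue , red)) 2)
                     (trans (cong (_+ (smallest2 (blue , red) / 2) * 2) ev)
                            (*-comm (smallest2 (blue , red) / 2) 2))
...   | no ¬m | _ = no λ { (m , m≥1 , eq , _) → ¬m (subst (1 ≤_) (sym (h m eq)) m≥1) }
  where h : ∀ m → smallest2 (blue , red) ≡ 2 * m → smallest2 (blue , red) / 2 ≡ m
        h m eq = trans (cong (_/ 2) eq) (trans (cong (_/ 2) (*-comm 2 m)) (m*n/n≡m m 2))
...   | yes _ | no ¬ok = no λ { (m , _ , eq , ok) → ¬ok (subst (λ k → All (λ x → (x % 2 ≡ 0) × (2 * k < x) × (x ≤ 4 * k)) red) (sym (h m eq)) ok) }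
  where h : ∀ m → smallest2 (blue , red) ≡ 2 * m → smallest2 (blue , red) / 2 ≡ m
        h m eq = trans (cong (_/ 2) eq) (trans (cong (_/ 2) (*-comm 2 m)) (m*n/n≡m m 2))

G : ℕ → ℕ
G n = length (filter gCond? (twoColour n))

private
  test1 : G 8 ≡ 7
  test1 = refl
  test2 : NoPlus 8 ≡ 7
  test2 = refl

{-# OPTIONS --safe #-}

-- Write (a)_N = (a;q)_N. Compare both sides with P = 1/(q)_∞ and with the generating
-- function f of (-1)^rank. Conjugation exchanges positive and negative ranks, so
-- P - f = 4 Σ N_o⁺(n) q^n. Also f = 2 - Y(-q), where Y(t) = Σ_{N≥0} t^N/(-q)_N satisfies
-- Y(t) + Y(tq) = 2 + t Y(t). On the other side, Euler's expansion gives
--   Σ G(n) q^n = (-q)_∞ Σ_{j≥0} 1/(q²;q²)_j Σ_{m≥1} q^{2m(j+1)}/(-q)_{2m},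
-- whose inner sum is ½(Y(t) + Y(-t)) - 1 at t = q^{j+1}. With α_{j+1} = Y(q^{j+1})/(q)_j and
-- β_{j+1} = Y(-q^{j+1})/(-q)_j, the recursion for Y says α_j + α_{j+1} = 2/(q)_j and
-- β_j + β_{j+1} = 2/(-q)_j (α_0 = 1/(-q)_∞, β_0 = f), and then four times the j-th summand is
-- α_{j+1} β_{j+1} - α_j β_j. The sum telescopes to 4 Σ G(n) q^n = P - f.
-- All of this takes place modulo q^{2n+1}, where sums and products are finite and 1 ± q^k is
-- invertible for k ≥ 1.
module Submission where

open import Defs
open import Algebra.Bundles using (CommutativeMonoid; CommutativeRing)
import Algebra.Properties.CommutativeMonoid.Sum as MonoidSum
import Algebra.Properties.CommutativeSemiring.Exp as Exp
import Algebra.Properties.Ring as RingProperties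
import Algebra.Properties.Semiring.Sum as SemiringSum
import Algebra.Solver.Ring.NaturalCoefficients.Default as NatSolver
open import Data.Bool using (if_then_else_; _∧_; true; false)
open import Data.Empty using (⊥-elim)
open import Data.Fin using (toℕ)
open import Data.Fin.Properties using (toℕ<n)
open import Data.Integer as ℤ using (ℤ; 0ℤ; 1ℤ)
import Data.Integer.Properties as ℤ
open import Data.Integer.Tactic.RingSolver using (solve-∀)
open import Data.List using (List; []; _∷_; _++_; concatMap; map; filter; upTo; applyUpTo; length)
open import Data.List.Properties using (concatMap-cong)
open import Data.List.Relation.Unary.All as All using (All; []; _∷_; all?)
import Data.List.Relation.Unary.All.Properties as All
open import Data.Nat as ℕ using (ℕ; zero; suc; _≤_; _<_; z≤n; s≤s; _∸_; _%_; _<ᵇ_; _≤?_)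
open import Data.Nat.DivMod using ([m+kn]%n≡m%n; m*n%n≡0)
import Data.Nat.Properties as ℕ
import Data.Nat.Tactic.RingSolver as ℕ-Solver
open import Data.Product using (_×_; _,_; proj₂)
open import Data.Sum using (inj₁; inj₂)
open import Level using (Level; 0ℓ; _⊔_)
import Relation.Binary.Reasoning.Setoid as SetoidReasoning
open import Relation.Binary.PropositionalEquality as ≡ using (_≡_; _≢_)
open import Relation.Nullary using (Dec; does; yes; no; ¬_)
open import Relation.Nullary.Decidable using (_×-dec_)
open import Relation.Unary using (Pred; Decidable)

-- The overview names Euler's expansion without saying why it applies. The m-th term of the series
-- for G contains 1/((q^(2m+2);q²)_m (q^(2m);q)_∞). Since (-x;q)_∞ = (x²;q²)_∞/(x;q)_∞, taking x =
-- q^(2m+1) shows that this equals (-q^(2m+1);q)_∞/(q^(2m);q²)_∞: the red exponents 2m+2, ..., 4m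
-- are exactly those that 4m+2, 4m+4, ... lack to make up (q^(2m+2);q²)_∞. So the interval (2m, 4m]
-- is what produces a product in base q², whose expansion separates m from j. The factor 4 has two
-- sources: 1 - (-1)^rank is 2 at odd rank, and an odd rank is never 0, so the odd ranks divide
-- evenly between the two signs. The q-series part works in an arbitrary commutative ring with a
-- nilpotent q, where ½ need not exist; every identity therefore keeps its factor 2 or 4, and the
-- division happens once, in ℤ. Infinite products and the conjugation bijection are replaced
-- throughout by recursions in an index, anchored where the index is 0 or where the power of q
-- vanishes.

-- Unfolding the enumeration of partitions

fuel-irrelevant : {F : ℕ → ℕ → ℕ → ℕ → ℕ → List (List ℕ)} →
  (∀ b n f c → F b n f c zero ≡ [] ∷ []) →
  (∀ b n f c m → F b n (suc f) c (suc m) ≡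
     concatMap (λ k → map (suc k ∷_) (F b n f (suc k) (m ∸ k)))
               (filter (λ k → suc k ≤? c) (upTo (suc m)))) →
  ∀ {b n b′ n′} f f′ c m → m ≤ f → m ≤ f′ → F b n f c m ≡ F b′ n′ f′ c m
fuel-irrelevant e₀ e₁ f f′ c zero _ _ = ≡.trans (e₀ _ _ f c) (≡.sym (e₀ _ _ f′ c))
fuel-irrelevant {F} e₀ e₁ (suc f) (suc f′) c (suc m) (s≤s p) (s≤s p′) =
  ≡.trans (e₁ _ _ f c m) (≡.trans (concatMap-cong step (filter (λ k → suc k ≤? c) (upTo (suc m)))) (≡.sym (e₁ _ _ f′ c m)))
  where
  step : ∀ k → map (suc k ∷_) (F _ _ f (suc k) (m ∸ k)) ≡ map (suc k ∷_) (F _ _ f′ (suc k) (m ∸ k))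
  step k =
    ≡.cong (map (suc k ∷_)) (fuel-irrelevant {F} e₀ e₁ f f′ (suc k) (m ∸ k) (ℕ.≤-trans (ℕ.m∸n≤m m k) p) (ℕ.≤-trans (ℕ.m∸n≤m m k) p′))

partsLE-suc : ∀ b n → partsLE b (suc n) ≡
  concatMap (λ k → map (suc k ∷_) (partsLE (suc k) (n ∸ k)))
            (filter (λ k → suc k ≤? b) (upTo (suc n)))
-- The recursive call inside `partsLE b (suc n)` still carries the enclosing `b` and `suc n` as
-- parameters and has fuel `n`, while `partsLE (suc k) (n ∸ k)` starts with parameters and fuel of
-- its own. This is why `fuel-irrelevant` lets the first two arguments of `F` differ on the two
-- sides.
refuel : ∀ b n k → _ ≡ partsLE (suc k) (n ∸ k)
go : ℕ → ℕ → ℕ → ℕ → ℕ → List (List ℕ)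
go-zero : ∀ b n f c → go b n f c zero ≡ [] ∷ []
go-suc : ∀ b n f c m → go b n (suc f) c (suc m) ≡
  concatMap (λ k → map (suc k ∷_) (go b n f (suc k) (m ∸ k)))
            (filter (λ k → suc k ≤? c) (upTo (suc m)))

-- The local function of partsLE cannot be named; unification in refuel solves go to it.
go = _
partsLE-suc b n =
  concatMap-cong (λ k → ≡.cong (map (suc k ∷_)) (refuel b n k))
                 (filter (λ k → suc k ≤? b) (upTo (suc n)))
-- Generalising these expressions to variables leaves `go` applied to distinct variables, so that
-- the unification problem has a unique solution.
refuel b n k with suc n | suc k | n ∸ k | ℕ.m∸n≤m n k
... | N | j | m | m≤n = fuel-irrelevant {go} go-zero go-suc {b} {N} {j} {m} n m j m m≤n ℕ.≤-refl
go-zero b n f c = ≡.refl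
go-suc b n f c m = ≡.refl

-- Finite sums and products

module BigOperator {c ℓ : Level} (M : CommutativeMonoid c ℓ) where
  open CommutativeMonoid M
  open MonoidSum M using (sum; sum-cong-≋; ∑-distrib-+; ∑-comm)

  big : ℕ → (ℕ → Carrier) → Carrier
  big n f = sum {n} (λ i → f (toℕ i))

  big-cong : ∀ n {f g} → (∀ i → i < n → f i ≈ g i) → big n f ≈ big n g
  big-cong n f≈g = sum-cong-≋ {n} (λ i → f≈g (toℕ i) (toℕ<n i))

  big-last : ∀ n f → big (suc n) f ≈ big n f ∙ f n
  big-last zero f = comm _ _
  big-last (suc n) f = trans (∙-congˡ (big-last n (λ i → f (suc i)))) (sym (assoc _ _ _))

  big-ε : ∀ n {f} → (∀ i → i < n → f i ≈ ε) → big n f ≈ ε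
  big-ε zero _ = refl
  big-ε (suc n) f≈ε =
    trans (∙-cong (f≈ε 0 (s≤s z≤n)) (big-ε n (λ i i<n → f≈ε (suc i) (s≤s i<n)))) (identityˡ ε)

  big-∙ : ∀ n f g → big n (λ i → f i ∙ g i) ≈ big n f ∙ big n g
  big-∙ n f g = ∑-distrib-+ {n} (λ i → f (toℕ i)) (λ i → g (toℕ i))

  big-swap : ∀ m n (f : ℕ → ℕ → Carrier) → big m (λ i → big n (f i)) ≈ big n (λ j → big m (λ i → f i j))
  big-swap m n f = ∑-comm {m} {n} (λ i j → f (toℕ i) (toℕ j))

module RingSum {c ℓ : Level} (R : CommutativeRing c ℓ) where
  open CommutativeRing R hiding (zero)
  open BigOperator +-commutativeMonoid public using ()
    renaming (big to Σ<; big-cong to Σ-cong; big-last to Σ-last; big-ε to Σ-zero; big-∙ to Σ-+; big-swap to Σ-swap)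
  open BigOperator *-commutativeMonoid public using ()
    renaming (big to Π<; big-cong to Π-cong; big-last to Π-last; big-ε to Π-one; big-∙ to Π-*)

  *-distribˡ-Σ : ∀ n x f → x * Σ< n f ≈ Σ< n (λ i → x * f i)
  *-distribˡ-Σ n x f = SemiringSum.*-distribˡ-sum semiring {n} x (λ i → f (toℕ i))

-- The q-series identity

module QIdentity {a ℓ : Level} (R : CommutativeRing a ℓ) (q : CommutativeRing.Carrier R) (n : ℕ)
  (q-nilpotent : CommutativeRing._≈_ R (Exp._^_ (CommutativeRing.commutativeSemiring R) q (suc (n ℕ.* 2))) (CommutativeRing.0# R))
  where
  open CommutativeRing R hiding (zero)
  open Exp commutativeSemiring
  open RingSum R public
  open RingProperties ring using (+-cancelʳ; -1*x≈-x; -‿involutive)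
  open NatSolver commutativeSemiring using (solve; _:+_; _:*_; _:=_; con)
  open SetoidReasoning setoid

  -- Only the coefficient of q^n is read off in the end, but with precision 2n + 1 the indices 0,
  -- ..., 2n of the truncated `Y` are 0 followed by n pairs (2m - 1, 2m). The even part then has
  -- exactly the terms m = 1, ..., n.
  L K : ℕ
  L = n ℕ.* 2
  K = suc L

  2# 4# -1# : Carrier
  2# = 1# + 1#
  4# = 2# + 2#
  -1# = - 1#

  -- Nilpotency of q and inverses of 1 ± q^k

  q^-high : ∀ k → K ≤ k → q ^ k ≈ 0#
  q^-high k K≤k = begin
    q ^ k                     ≡⟨ ≡.cong (q ^_) (ℕ.m+[n∸m]≡n K≤k) ⟨
    q ^ (K ℕ.+ (k ℕ.∸ K))     ≈⟨ ^-homo-* q K (k ℕ.∸ K) ⟩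
    q ^ K * q ^ (k ℕ.∸ K)     ≈⟨ *-congʳ q-nilpotent ⟩
    0# * q ^ (k ℕ.∸ K)        ≈⟨ zeroˡ _ ⟩
    0#                        ∎

  x≈0⇒1+x*y≈1 : ∀ {x} y → x ≈ 0# → 1# + x * y ≈ 1#
  x≈0⇒1+x*y≈1 y x≈0 = trans (+-congˡ (trans (*-congʳ x≈0) (zeroˡ y))) (+-identityʳ 1#)

  -- Negation is written as multiplication by `-1#`, an atom for semiring normalisation; this
  -- cancellation is then applied by hand.
  x+-1x≈0 : ∀ x → x + -1# * x ≈ 0#
  x+-1x≈0 x = trans (+-congˡ (-1*x≈-x x)) (-‿inverseʳ x)

  -- The geometric series for 1/(1 - x), exact once x^K vanishes.
  inv : Carrier → Carrier
  inv x = Σ< K (x ^_)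

  inv-eq : ∀ x → x ^ K ≈ 0# → inv x ≈ 1# + x * inv x
  inv-eq x x^K≈0 = begin
    inv x                       ≈⟨ +-identityʳ _ ⟨
    inv x + 0#                  ≈⟨ +-congˡ x^K≈0 ⟨
    inv x + x ^ K               ≈⟨ Σ-last K (x ^_) ⟨
    1# + Σ< K (λ i → x * x ^ i) ≈⟨ +-congˡ (*-distribˡ-Σ K x (x ^_)) ⟨
    1# + x * inv x              ∎

  -- The equation y(1 - x) = 1 is put without subtraction, so that semiring identities suffice: both
  -- sides gain x y z, which is cancelled at the end. Later proofs that begin with `+-cancelʳ`
  -- follow the same pattern.
  inv-unique : ∀ {x y z} → y ≈ 1# + x * y → z ≈ 1# + x * z → y ≈ z
  inv-unique {x} {y} {z} y-eq z-eq = +-cancelʳ (x * (y * z)) y z (begin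
    y + x * (y * z)    ≈⟨ solve 3 (λ x y z → y :+ x :* (y :* z) := y :* (con 1 :+ x :* z)) refl x y z ⟩
    y * (1# + x * z)   ≈⟨ *-congˡ z-eq ⟨
    y * z              ≈⟨ *-congʳ y-eq ⟩
    (1# + x * y) * z   ≈⟨ solve 3 (λ x y z → (con 1 :+ x :* y) :* z := z :+ x :* (y :* z)) refl x y z ⟩
    z + x * (y * z)    ∎)

  [q^k]^K≈0 : ∀ k → (q ^ suc k) ^ K ≈ 0#
  [q^k]^K≈0 k = trans (^-assocʳ q (suc k) K) (q^-high _ (ℕ.m≤m+n K (k ℕ.* K)))

  [-x]^K≈0 : ∀ x → x ^ K ≈ 0# → (-1# * x) ^ K ≈ 0#
  [-x]^K≈0 x x^K≈0 = trans (^-distrib-* -1# x K) (trans (*-congˡ x^K≈0) (zeroʳ _))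

  -- u k = 1/(1 - q^k) and v k = 1/(1 + q^k), for k ≥ 1.
  u v : ℕ → Carrier
  u k = inv (q ^ k)
  v k = inv (-1# * q ^ k)

  u-eq : ∀ k → u (suc k) ≈ 1# + q ^ suc k * u (suc k)
  u-eq k = inv-eq _ ([q^k]^K≈0 k)

  v-eq : ∀ k → v (suc k) + q ^ suc k * v (suc k) ≈ 1#
  v-eq k = begin
    v (suc k) + x * v (suc k)                        ≈⟨ +-congʳ (inv-eq _ ([-x]^K≈0 x ([q^k]^K≈0 k))) ⟩
    1# + (-1# * x) * v (suc k) + x * v (suc k)
      ≈⟨ solve 3 (λ m x v → con 1 :+ (m :* x) :* v :+ x :* v := con 1 :+ (x :+ m :* x) :* v) refl -1# x (v (suc k)) ⟩
    1# + (x + -1# * x) * v (suc k)                   ≈⟨ x≈0⇒1+x*y≈1 _ (x+-1x≈0 x) ⟩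
    1#                                               ∎
    where
    x : Carrier
    x = q ^ suc k

  u-cancel : ∀ k {x y} → u (suc k) * x ≈ u (suc k) * y → x ≈ y
  u-cancel k {x} {y} ux≈uy = +-cancelʳ (Q * (U * x)) x y (begin
    x + Q * (U * x)   ≈⟨ expand x ⟩
    U * x             ≈⟨ ux≈uy ⟩
    U * y             ≈⟨ expand y ⟨
    y + Q * (U * y)   ≈⟨ +-congˡ (*-congˡ ux≈uy) ⟨
    y + Q * (U * x)   ∎)
    where
    U Q : Carrier
    U = u (suc k)
    Q = q ^ suc k
    expand : ∀ z → z + Q * (U * z) ≈ U * z
    expand z =
      trans (solve 3 (λ Q U z → z :+ Q :* (U :* z) := (con 1 :+ Q :* U) :* z) refl Q U z) (*-congʳ (sym (u-eq k)))

  -- Turns the recursion of a generating function in which one part size may be repeated at will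
  -- into a factor 1/(1 - q^(k+1)).
  divide : ∀ k {x y} → x ≈ y + q ^ suc k * x → x ≈ y * u (suc k)
  divide k {x} {y} eq = +-cancelʳ (U * (Q * x)) _ _ (begin
    x + U * (Q * x)         ≈⟨ solve 3 (λ U Q x → x :+ U :* (Q :* x) := (con 1 :+ Q :* U) :* x) refl U Q x ⟩
    (1# + Q * U) * x        ≈⟨ *-congʳ (u-eq k) ⟨
    U * x                   ≈⟨ *-congˡ eq ⟩
    U * (y + Q * x)         ≈⟨ solve 3 (λ U y p → U :* (y :+ p) := y :* U :+ U :* p) refl U y (Q * x) ⟩
    y * U + U * (Q * x)     ∎)
    where
    U Q : Carrier
    U = u (suc k)
    Q = q ^ suc k

  v-cancel : ∀ k {x y} → x * v (suc k) ≈ y * v (suc k) → x ≈ y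
  v-cancel k {x} {y} xv≈yv = trans (expand x) (trans (*-congˡ xv≈yv) (sym (expand y)))
    where
    V Q : Carrier
    V = v (suc k)
    Q = q ^ suc k
    expand : ∀ z → z ≈ (1# + Q) * (z * V)
    expand z =
      sym (trans (solve 3 (λ Q V z → (con 1 :+ Q) :* (z :* V) :=
           z :* (V :+ Q :* V)) refl Q V z) (trans (*-congˡ (v-eq k)) (*-identityʳ z)))

  -- Difference of squares: 1 - x² = (1 - x)(1 + x) at x = q^(k+1).
  u-double : ∀ k → u (suc k ℕ.* 2) ≈ u (suc k) * v (suc k)
  u-double k = inv-unique (u-eq (suc (k ℕ.* 2))) (+-cancelʳ (Q * (U * V)) _ _ (begin
    U * V + Q * (U * V)
      ≈⟨ solve 3 (λ Q U V → U :* V :+ Q :* (U :* V) := U :* (V :+ Q :* V)) refl Q U V ⟩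
    U * (V + Q * V)                        ≈⟨ *-congˡ (v-eq k) ⟩
    U * 1#                                 ≈⟨ *-identityʳ U ⟩
    U                                      ≈⟨ u-eq k ⟩
    1# + Q * U                             ≈⟨ +-congˡ (*-congˡ (*-identityʳ U)) ⟨
    1# + Q * (U * 1#)                      ≈⟨ +-congˡ (*-congˡ (*-congˡ (v-eq k))) ⟨
    1# + Q * (U * (V + Q * V))
      ≈⟨ solve 3 (λ Q U V → con 1 :+ Q :* (U :* (V :+ Q :* V)) :=
           con 1 :+ (Q :* (Q :* con 1)) :* (U :* V) :+ Q :* (U :* V)) refl Q U V ⟩
    1# + Q ^ 2 * (U * V) + Q * (U * V)     ≈⟨ +-congʳ (+-congˡ (*-congʳ (^-assocʳ q (suc k) 2))) ⟩
    1# + q ^ (suc k ℕ.* 2) * (U * V) + Q * (U * V) ∎))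
    where
    U V Q : Carrier
    U = u (suc k)
    V = v (suc k)
    Q = q ^ suc k

  u-high : ∀ k → K ≤ k → u k ≈ 1#
  u-high (suc k) K≤k = trans (u-eq k) (x≈0⇒1+x*y≈1 _ (q^-high _ K≤k))

  v-high : ∀ k → K ≤ suc k → v (suc k) ≈ 1#
  v-high k K≤k = begin
    v (suc k)                          ≈⟨ +-identityʳ _ ⟨
    v (suc k) + 0#                     ≈⟨ +-congˡ (trans (*-congʳ (q^-high _ K≤k)) (zeroˡ _)) ⟨
    v (suc k) + q ^ suc k * v (suc k)  ≈⟨ v-eq k ⟩
    1#                                 ∎

  -- r N = 1/(q;q)_N and c N = 1/(-q;q)_N, so that r N * c N = 1/(q²;q²)_N.
  r c : ℕ → Carrier
  r N = Π< N (λ i → u (suc i))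
  c N = Π< N (λ i → v (suc i))

  -- This is (-q;q)_∞ at the given precision, because 1 + q^k is 1 for k > L.
  e : Carrier
  e = Π< L (λ i → 1# + q ^ suc i)

  r-suc : ∀ N → r (suc N) ≈ r N + q ^ suc N * r (suc N)
  r-suc N = begin
    r (suc N)                                ≈⟨ Π-last N (λ i → u (suc i)) ⟩
    r N * u (suc N)                          ≈⟨ *-congˡ (u-eq N) ⟩
    r N * (1# + q ^ suc N * u (suc N))
      ≈⟨ solve 3 (λ r Q u → r :* (con 1 :+ Q :* u) := r :+ Q :* (r :* u)) refl (r N) (q ^ suc N) (u (suc N)) ⟩
    r N + q ^ suc N * (r N * u (suc N))      ≈⟨ +-congˡ (*-congˡ (Π-last N (λ i → u (suc i)))) ⟨
    r N + q ^ suc N * r (suc N)              ∎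

  c-suc : ∀ N → c (suc N) + q ^ suc N * c (suc N) ≈ c N
  c-suc N = begin
    c (suc N) + Q * c (suc N)       ≈⟨ +-cong last (*-congˡ last) ⟩
    c N * V + Q * (c N * V)
      ≈⟨ solve 3 (λ c Q V → c :* V :+ Q :* (c :* V) := c :* (V :+ Q :* V)) refl (c N) Q V ⟩
    c N * (V + Q * V)                ≈⟨ *-congˡ (v-eq N) ⟩
    c N * 1#                         ≈⟨ *-identityʳ _ ⟩
    c N                              ∎
    where
    V Q : Carrier
    V = v (suc N)
    Q = q ^ suc N
    last : c (suc N) ≈ c N * V
    last = Π-last N (λ i → v (suc i))

  e*c≈1 : ∀ d → e * c (L ℕ.+ d) ≈ 1#
  e*c≈1 zero rewrite ℕ.+-identityʳ L = begin
    e * c L                                        ≈⟨ Π-* L (λ i → 1# + q ^ suc i) (λ i → v (suc i)) ⟨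
    Π< L (λ i → (1# + q ^ suc i) * v (suc i))
      ≈⟨ Π-one L (λ i _ → trans (trans (distribʳ _ _ _) (+-congʳ (*-identityˡ _))) (v-eq i)) ⟩
    1#                                              ∎
  e*c≈1 (suc d) rewrite ℕ.+-suc L d = begin
    e * c (suc (L ℕ.+ d))                 ≈⟨ *-congˡ (Π-last (L ℕ.+ d) (λ i → v (suc i))) ⟩
    e * (c (L ℕ.+ d) * v (suc (L ℕ.+ d))) ≈⟨ *-congˡ (*-congˡ (v-high _ (s≤s (ℕ.m≤m+n L d)))) ⟩
    e * (c (L ℕ.+ d) * 1#)                ≈⟨ *-congˡ (*-identityʳ _) ⟩
    e * c (L ℕ.+ d)                       ≈⟨ e*c≈1 d ⟩
    1#                                     ∎

  -- Fine's function Σ t^N/(-q;q)_N.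
  Y : Carrier → Carrier
  Y t = Σ< K (λ N → t ^ N * c N)

  Y-cong : ∀ {s t} → s ≈ t → Y s ≈ Y t
  Y-cong {s} {t} s≈t = Σ-cong K {λ N → s ^ N * c N} {λ N → t ^ N * c N} (λ N _ → *-congʳ (^-congˡ N s≈t))

  Y-zero : ∀ {t} → t ≈ 0# → Y t ≈ 1#
  Y-zero {t} t≈0 = begin
    1# * 1# + Σ< L (λ N → t * t ^ N * c (suc N))
      ≈⟨ +-cong (*-identityˡ _) (Σ-zero L {λ N → t * t ^ N * c (suc N)} (λ N _ → trans (*-congʳ (trans (*-congʳ t≈0) (zeroˡ _))) (zeroˡ _))) ⟩
    1# + 0#                                      ≈⟨ +-identityʳ _ ⟩
    1#                                           ∎

  -- Termwise: for i ≥ 1 the two i-th terms add up to t^i (1 + q^i) `c i` = t · t^(i-1) `c (i-1)`,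
  -- and the terms at 0 give 2. The sum on the right is one term shorter; in `Y-shift` the missing
  -- term is a multiple of t^K.
  Y-shift-finite : ∀ t N →
    Σ< (suc N) (λ i → t ^ i * c i) + Σ< (suc N) (λ i → (t * q) ^ i * c i) ≈
    2# + t * Σ< N (λ i → t ^ i * c i)
  Y-shift-finite t zero =
    solve 1 (λ t → (con 1 :* con 1 :+ con 0) :+ (con 1 :* con 1 :+ con 0) := con 1 :+ con 1 :+ t :* con 0) refl t
  Y-shift-finite t (suc N) = begin
    Σ< (suc (suc N)) f + Σ< (suc (suc N)) g
      ≈⟨ +-cong (Σ-last (suc N) f) (trans (Σ-last (suc N) g) (+-congˡ (*-congʳ (^-distrib-* t q (suc N))))) ⟩
    (A + t ^ suc N * C) + (B + (t ^ suc N * q ^ suc N) * C)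
      ≈⟨ solve 5 (λ A B T Q C → (A :+ T :* C) :+ (B :+ (T :* Q) :* C) :=
           A :+ B :+ T :* (C :+ Q :* C)) refl A B (t ^ suc N) (q ^ suc N) C ⟩
    A + B + t ^ suc N * (C + q ^ suc N * C)
      ≈⟨ +-cong (Y-shift-finite t N) (*-congˡ (c-suc N)) ⟩
    2# + t * Σ< N f + t * t ^ N * c N
      ≈⟨ solve 4 (λ t S T C → (con 1 :+ con 1) :+ t :* S :+ t :* T :* C :=
           (con 1 :+ con 1) :+ t :* (S :+ T :* C)) refl t (Σ< N f) (t ^ N) (c N) ⟩
    2# + t * (Σ< N f + t ^ N * c N)
      ≈⟨ +-congˡ (*-congˡ (Σ-last N f)) ⟨
    2# + t * Σ< (suc N) f ∎
    where
    f g : ℕ → Carrier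
    f i = t ^ i * c i
    g i = (t * q) ^ i * c i
    A B C : Carrier
    A = Σ< (suc N) f
    B = Σ< (suc N) g
    C = c (suc N)

  Y-shift : ∀ t → t ^ K ≈ 0# → Y t + Y (t * q) ≈ 2# + t * Y t
  Y-shift t t^K≈0 = trans (Y-shift-finite t L) (+-congˡ (sym (begin
    t * Y t                              ≈⟨ *-congˡ (Σ-last L (λ i → t ^ i * c i)) ⟩
    t * (S + t ^ L * c L)
      ≈⟨ solve 4 (λ t S T C → t :* (S :+ T :* C) := t :* S :+ (t :* T) :* C) refl t S (t ^ L) (c L) ⟩
    t * S + t ^ K * c L                 ≈⟨ +-congˡ (trans (*-congʳ t^K≈0) (zeroˡ _)) ⟩
    t * S + 0#                           ≈⟨ +-identityʳ _ ⟩
    t * S                                ∎)))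
    where
    S : Carrier
    S = Σ< L (λ i → t ^ i * c i)

  -- Telescoping of q^i `c i` = `c (i-1)` - `c i`. This stands in for `Y-shift` at t = 1, where t^K
  -- does not vanish; the boundary term `c N` that survives is the origin of `α 0`.
  Y-q-finite : ∀ N → Σ< (suc N) (λ i → q ^ i * c i) + c N ≈ 2#
  Y-q-finite zero = solve 0 ((con 1 :* con 1 :+ con 0) :+ con 1 := con 1 :+ con 1) refl
  Y-q-finite (suc N) = begin
    Σ< (suc (suc N)) f + c (suc N)           ≈⟨ +-congʳ (Σ-last (suc N) f) ⟩
    Σ< (suc N) f + f (suc N) + c (suc N)
      ≈⟨ solve 3 (λ S F C → S :+ F :+ C := S :+ (C :+ F)) refl (Σ< (suc N) f) (f (suc N)) (c (suc N)) ⟩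
    Σ< (suc N) f + (c (suc N) + f (suc N))   ≈⟨ +-congˡ (c-suc N) ⟩
    Σ< (suc N) f + c N                       ≈⟨ Y-q-finite N ⟩
    2#                                        ∎
    where
    f : ℕ → Carrier
    f i = q ^ i * c i

  evenPart : ℕ → Carrier → Carrier
  evenPart N t = Σ< N (λ m → t ^ (suc m ℕ.* 2) * c (suc m ℕ.* 2))

  neg-even : ∀ t k → (-1# * t) ^ (k ℕ.* 2) ≈ t ^ (k ℕ.* 2)
  neg-even t zero = refl
  neg-even t (suc k) = begin
    -1# * t * (-1# * t * (-1# * t) ^ (k ℕ.* 2))
      ≈⟨ solve 3 (λ m t p → m :* t :* (m :* t :* p) := m :* m :* (t :* (t :* p))) refl -1# t _ ⟩
    -1# * -1# * (t * (t * (-1# * t) ^ (k ℕ.* 2)))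
      ≈⟨ *-cong (trans (-1*x≈-x -1#) (-‿involutive 1#)) (*-congˡ (*-congˡ (neg-even t k))) ⟩
    1# * (t * (t * t ^ (k ℕ.* 2)))                ≈⟨ *-identityˡ _ ⟩
    t ^ (suc k ℕ.* 2)                             ∎

  -- Odd powers of t cancel and even ones double; the lone 2 comes from the two terms of index 0,
  -- which `evenPart` omits.
  Y-even : ∀ t N →
    Σ< (suc (N ℕ.* 2)) (λ i → t ^ i * c i) + Σ< (suc (N ℕ.* 2)) (λ i → (-1# * t) ^ i * c i) ≈
    2# + 2# * evenPart N t
  Y-even t zero =
    solve 0 ((con 1 :* con 1 :+ con 0) :+ (con 1 :* con 1 :+ con 0) := con 1 :+ con 1 :+ (con 1 :+ con 1) :* con 0) refl
  Y-even t (suc N) = begin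
    Σ< (3 ℕ.+ M) f + Σ< (3 ℕ.+ M) g
      ≈⟨ +-cong (last₂ f) (last₂ g) ⟩
    (Σ< (suc M) f + f (1 ℕ.+ M) + F₂) + (Σ< (suc M) g + g (1 ℕ.+ M) + g (2 ℕ.+ M))
      ≈⟨ +-congˡ (+-cong (+-congˡ (trans (*-congʳ (*-congˡ (neg-even t N))) (solve 4 (λ m t T C → m :* t :* T :* C :=
           m :* (t :* T :* C)) refl -1# t (t ^ M) (c (suc M))))) (*-congʳ (neg-even t (suc N)))) ⟩
    (Σ< (suc M) f + f (1 ℕ.+ M) + F₂) + (Σ< (suc M) g + -1# * f (1 ℕ.+ M) + F₂)
      ≈⟨ solve 5 (λ A B x y F → (A :+ x :+ F) :+ (B :+ y :+ F) :=
           (A :+ B) :+ (con 1 :+ con 1) :* F :+ (x :+ y)) refl _ _ _ _ F₂ ⟩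
    (Σ< (suc M) f + Σ< (suc M) g) + 2# * F₂ + (f (1 ℕ.+ M) + -1# * f (1 ℕ.+ M))
      ≈⟨ +-cong (+-congʳ (Y-even t N)) (x+-1x≈0 _) ⟩
    2# + 2# * evenPart N t + 2# * F₂ + 0#
      ≈⟨ solve 2 (λ E F → (con 1 :+ con 1) :+ (con 1 :+ con 1) :* E :+ (con 1 :+ con 1) :* F :+ con 0 :=
           (con 1 :+ con 1) :+ (con 1 :+ con 1) :* (E :+ F)) refl (evenPart N t) F₂ ⟩
    2# + 2# * (evenPart N t + F₂)
      ≈⟨ +-congˡ (*-congˡ (Σ-last N (λ m → t ^ (suc m ℕ.* 2) * c (suc m ℕ.* 2)))) ⟨
    2# + 2# * evenPart (suc N) t ∎
    where
    M : ℕ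
    M = N ℕ.* 2
    f g : ℕ → Carrier
    f i = t ^ i * c i
    g i = (-1# * t) ^ i * c i
    F₂ : Carrier
    F₂ = f (2 ℕ.+ M)
    last₂ : ∀ h → Σ< (3 ℕ.+ M) h ≈ Σ< (suc M) h + h (1 ℕ.+ M) + h (2 ℕ.+ M)
    last₂ h = trans (Σ-last (2 ℕ.+ M) h) (+-congʳ (Σ-last (suc M) h))

  -- The telescoping sum

  α β : ℕ → Carrier
  α zero = c L
  α (suc j) = Y (q ^ suc j) * r j
  β zero = 2# + -1# * Y (-1# * q)
  β (suc j) = Y (-1# * q ^ suc j) * c j

  -- The factors `r` and `c` act as summation factors. In the form (1 - t) Y(t) + Y(tq) = 2, the
  -- recursion at t = q^j has the coefficient 1 - q^j, and multiplying by `r j` turns it into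
  -- `r (j-1)`; at t = -q^j the coefficient 1 + q^j is absorbed by `c j` in the same way, which
  -- gives `β-rec`.
  α-rec : ∀ j → α j + α (suc j) ≈ 2# * r j
  α-rec zero = begin
    c L + Y (q * 1#) * 1#  ≈⟨ +-congˡ (trans (*-identityʳ _) (Y-cong (*-identityʳ q))) ⟩
    c L + Y q              ≈⟨ +-comm _ _ ⟩
    Y q + c L              ≈⟨ Y-q-finite L ⟩
    2#                     ≈⟨ *-identityʳ 2# ⟨
    2# * 1#                ∎
  α-rec (suc j) = +-cancelʳ (Q * (A * r (suc j))) _ _ (begin
    A * r j + A′ * r (suc j) + Q * (A * r (suc j))
      ≈⟨ solve 5 (λ Q A A′ r r′ → A :* r :+ A′ :* r′ :+ Q :* (A :* r′) :=
           A :* (r :+ Q :* r′) :+ A′ :* r′) refl Q A A′ (r j) (r (suc j)) ⟩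
    A * (r j + Q * r (suc j)) + A′ * r (suc j)
      ≈⟨ +-congʳ (*-congˡ (r-suc j)) ⟨
    A * r (suc j) + A′ * r (suc j)
      ≈⟨ distribʳ _ _ _ ⟨
    (A + A′) * r (suc j)
      ≈⟨ *-congʳ (trans (+-congˡ (Y-cong (*-comm q Q))) (Y-shift Q ([q^k]^K≈0 j))) ⟩
    (2# + Q * A) * r (suc j)
      ≈⟨ solve 3 (λ Q A r′ → (con 1 :+ con 1 :+ Q :* A) :* r′ :=
           (con 1 :+ con 1) :* r′ :+ Q :* (A :* r′)) refl Q A (r (suc j)) ⟩
    2# * r (suc j) + Q * (A * r (suc j)) ∎)
    where
    Q A A′ : Carrier
    Q = q ^ suc j
    A = Y Q
    A′ = Y (q ^ suc (suc j))

  β-rec : ∀ j → β j + β (suc j) ≈ 2# * c j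
  β-rec zero = begin
    2# + -1# * B + Y (-1# * (q * 1#)) * 1#
      ≈⟨ +-congˡ (trans (*-identityʳ _) (Y-cong (*-congˡ (*-identityʳ q)))) ⟩
    2# + -1# * B + B
      ≈⟨ solve 2 (λ m B → con 1 :+ con 1 :+ m :+ B := (con 1 :+ con 1) :* con 1 :+ (B :+ m)) refl (-1# * B) B ⟩
    2# * 1# + (B + -1# * B)                 ≈⟨ +-congˡ (x+-1x≈0 B) ⟩
    2# * 1# + 0#                            ≈⟨ +-identityʳ _ ⟩
    2# * 1#                                 ∎
    where
    B : Carrier
    B = Y (-1# * q)
  β-rec (suc j) = begin
    B * c j + B′ * C                        ≈⟨ +-congʳ (*-congˡ (c-suc j)) ⟨
    B * (C + Q * C) + B′ * C
      ≈⟨ solve 4 (λ Q B B′ C → B :* (C :+ Q :* C) :+ B′ :* C := (B :+ B′ :+ Q :* B) :* C) refl Q B B′ C ⟩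
    (B + B′ + Q * B) * C                    ≈⟨ *-congʳ (+-congʳ (trans (+-congˡ (Y-cong shift)) (Y-shift (-1# * Q) ([-x]^K≈0 Q ([q^k]^K≈0 j))))) ⟩
    (2# + -1# * Q * B + Q * B) * C          ≈⟨ *-congʳ (solve 3 (λ m Q B → con 1 :+ con 1 :+ m :* Q :* B :+ Q :* B :=
         con 1 :+ con 1 :+ (Q :* B :+ m :* (Q :* B))) refl -1# Q B) ⟩
    (2# + (Q * B + -1# * (Q * B))) * C      ≈⟨ *-congʳ (trans (+-congˡ (x+-1x≈0 _)) (+-identityʳ _)) ⟩
    2# * C                                  ∎
    where
    Q B B′ C : Carrier
    Q = q ^ suc j
    B = Y (-1# * Q)
    B′ = Y (-1# * q ^ suc (suc j))
    C = c (suc j)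
    shift : -1# * (q * Q) ≈ -1# * Q * q
    shift = solve 3 (λ m q Q → m :* (q :* Q) := m :* Q :* q) refl -1# q Q

  T : ℕ → Carrier
  T j = r j * (c j * evenPart n (q ^ suc j))

  -- With a = α + α′ and b = β + β′ one has α′β′ + ab = αβ + aβ′ + bα′, and a, b are known from the
  -- recursions. The product ab = 4 `r j` `c j` is what the index-0 terms of `Y` contribute to the
  -- right-hand side, so it cancels.
  telescope-step : ∀ j → α (suc j) * β (suc j) ≈ α j * β j + 4# * T j
  telescope-step j = +-cancelʳ (4# * (r j * c j)) _ _ (begin
    α′ * β′ + 4# * (r j * c j)
      ≈⟨ +-congˡ (solve 2 (λ r c → (con 1 :+ con 1 :+ (con 1 :+ con 1)) :* (r :* c) :=
           ((con 1 :+ con 1) :* r) :* ((con 1 :+ con 1) :* c)) refl (r j) (c j)) ⟩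
    α′ * β′ + (2# * r j) * (2# * c j)
      ≈⟨ +-congˡ (*-cong (α-rec j) (β-rec j)) ⟨
    α′ * β′ + (α j + α′) * (β j + β′)
      ≈⟨ solve 4 (λ a a′ b b′ → a′ :* b′ :+ (a :+ a′) :* (b :+ b′) :=
           a :* b :+ ((a :+ a′) :* b′ :+ (b :+ b′) :* a′)) refl (α j) α′ (β j) β′ ⟩
    α j * β j + ((α j + α′) * β′ + (β j + β′) * α′)
      ≈⟨ +-congˡ (+-cong (*-congʳ (α-rec j)) (*-congʳ (β-rec j))) ⟩
    α j * β j + (2# * r j * (B * c j) + 2# * c j * (A * r j))
      ≈⟨ +-congˡ (solve 4 (λ A B r c → (con 1 :+ con 1) :* r :* (B :* c) :+ (con 1 :+ con 1) :* c :* (A :* r) :=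
           (con 1 :+ con 1) :* (r :* c) :* (A :+ B)) refl A B (r j) (c j)) ⟩
    α j * β j + 2# * (r j * c j) * (A + B)
      ≈⟨ +-congˡ (*-congˡ (Y-even (q ^ suc j) n)) ⟩
    α j * β j + 2# * (r j * c j) * (2# + 2# * evenPart n (q ^ suc j))
      ≈⟨ solve 4 (λ p r c E → p :+ (con 1 :+ con 1) :* (r :* c) :* (con 1 :+ con 1 :+ (con 1 :+ con 1) :* E) :=
           p :+ (con 1 :+ con 1 :+ (con 1 :+ con 1)) :* (r :* (c :* E)) :+ (con 1 :+ con 1 :+ (con 1 :+ con 1)) :* (r :* c)) refl (α j * β j) (r j) (c j) (evenPart n (q ^ suc j)) ⟩
    α j * β j + 4# * T j + 4# * (r j * c j) ∎)
    where
    A B α′ β′ : Carrier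
    A = Y (q ^ suc j)
    B = Y (-1# * q ^ suc j)
    α′ = α (suc j)
    β′ = β (suc j)

  telescope : ∀ N → α N * β N ≈ α 0 * β 0 + 4# * Σ< N T
  telescope zero = sym (trans (+-congˡ (zeroʳ _)) (+-identityʳ _))
  telescope (suc N) = begin
    α (suc N) * β (suc N)                        ≈⟨ telescope-step N ⟩
    α N * β N + 4# * T N                         ≈⟨ +-congʳ (telescope N) ⟩
    α 0 * β 0 + 4# * Σ< N T + 4# * T N           ≈⟨ +-assoc _ _ _ ⟩
    α 0 * β 0 + (4# * Σ< N T + 4# * T N)         ≈⟨ +-congˡ (distribˡ _ _ _) ⟨
    α 0 * β 0 + 4# * (Σ< N T + T N)              ≈⟨ +-congˡ (*-congˡ (Σ-last N T)) ⟨
    α 0 * β 0 + 4# * Σ< (suc N) T                ∎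

  -- At index `K` both arguments of `Y` vanish, so `α K * β K` is `r L * c L`; at index 0 the
  -- product is `c L * β 0`. Multiplying by `e` removes `c L` from both ends.
  telescoped : 4# * (e * Σ< K T) + β 0 ≈ r L
  telescoped = begin
    4# * (e * S) + β 0                    ≈⟨ +-congˡ (trans (*-congʳ e*c) (*-identityˡ _)) ⟨
    4# * (e * S) + e * c L * β 0
      ≈⟨ solve 4 (λ e S C b → (con 1 :+ con 1 :+ (con 1 :+ con 1)) :* (e :* S) :+ e :* C :* b :=
           e :* (C :* b :+ (con 1 :+ con 1 :+ (con 1 :+ con 1)) :* S)) refl e S (c L) (β 0) ⟩
    e * (α 0 * β 0 + 4# * S)              ≈⟨ *-congˡ (telescope K) ⟨
    e * (α K * β K)
      ≈⟨ *-congˡ (*-cong (trans (*-congʳ (Y-zero q-nilpotent)) (*-identityˡ _)) (trans (*-congʳ (Y-zero (trans (*-congˡ q-nilpotent) (zeroʳ _)))) (*-identityˡ _))) ⟩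
    e * (r L * c L)
      ≈⟨ solve 3 (λ e r c → e :* (r :* c) := e :* c :* r) refl e (r L) (c L) ⟩
    e * c L * r L                         ≈⟨ trans (*-congʳ e*c) (*-identityˡ _) ⟩
    r L                                   ∎
    where
    S : Carrier
    S = Σ< K T
    e*c : e * c L ≈ 1#
    e*c = trans (*-congˡ (reflexive (≡.cong c (≡.sym (ℕ.+-identityʳ L))))) (e*c≈1 0)

  -- E x = 1/(x;q²)_∞, by Euler's expansion.
  E : Carrier → Carrier
  E x = Σ< K (λ i → x ^ i * (r i * c i))

  -- The recursion `r-suc` in base q².
  rc-suc : ∀ i → r (suc i) * c (suc i) ≈ r i * c i + (q * q) ^ suc i * (r (suc i) * c (suc i))
  rc-suc i = +-cancelʳ (Q * (R₁ * C₁)) _ _ (begin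
    R₁ * C₁ + Q * (R₁ * C₁)
      ≈⟨ solve 3 (λ Q r c → r :* c :+ Q :* (r :* c) := r :* (c :+ Q :* c)) refl Q R₁ C₁ ⟩
    R₁ * (C₁ + Q * C₁)
      ≈⟨ *-cong (r-suc i) (c-suc i) ⟩
    (r i + Q * R₁) * c i
      ≈⟨ solve 4 (λ Q r r′ c → (r :+ Q :* r′) :* c := r :* c :+ Q :* (r′ :* c)) refl Q (r i) R₁ (c i) ⟩
    r i * c i + Q * (R₁ * c i)
      ≈⟨ +-congˡ (*-congˡ (*-congˡ (c-suc i))) ⟨
    r i * c i + Q * (R₁ * (C₁ + Q * C₁))
      ≈⟨ solve 4 (λ p Q r c → p :+ Q :* (r :* (c :+ Q :* c)) :=
           p :+ Q :* Q :* (r :* c) :+ Q :* (r :* c)) refl (r i * c i) Q R₁ C₁ ⟩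
    r i * c i + Q * Q * (R₁ * C₁) + Q * (R₁ * C₁)
      ≈⟨ +-congʳ (+-congˡ (*-congʳ (^-distrib-* q q (suc i)))) ⟨
    r i * c i + (q * q) ^ suc i * (R₁ * C₁) + Q * (R₁ * C₁) ∎)
    where
    Q R₁ C₁ : Carrier
    Q = q ^ suc i
    R₁ = r (suc i)
    C₁ = c (suc i)

  -- Termwise (1 - q^(2i)) `r i` `c i` = `r (i-1)` `c (i-1)`, which is E(x) - E(xq²) = x E(x) before
  -- the last term is dropped.
  E-shift-finite : ∀ x N →
    Σ< (suc N) (λ i → x ^ i * (r i * c i)) ≈
    x * Σ< N (λ i → x ^ i * (r i * c i)) + Σ< (suc N) (λ i → (x * (q * q)) ^ i * (r i * c i))
  E-shift-finite x zero =
    solve 1 (λ x → con 1 :* (con 1 :* con 1) :+ con 0 := x :* con 0 :+ (con 1 :* (con 1 :* con 1) :+ con 0)) refl x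
  E-shift-finite x (suc N) = begin
    Σ< (suc (suc N)) f
      ≈⟨ Σ-last (suc N) f ⟩
    Σ< (suc N) f + X * D
      ≈⟨ +-cong (E-shift-finite x N) (*-congˡ (rc-suc N)) ⟩
    x * Σ< N f + Σ< (suc N) g + X * (r N * c N + (q * q) ^ suc N * D)
      ≈⟨ solve 7 (λ x S G P d Q D → x :* S :+ G :+ x :* P :* (d :+ Q :* D) :=
           x :* (S :+ P :* d) :+ (G :+ x :* P :* Q :* D)) refl x (Σ< N f) (Σ< (suc N) g) (x ^ N) (r N * c N) ((q * q) ^ suc N) D ⟩
    x * (Σ< N f + x ^ N * (r N * c N)) + (Σ< (suc N) g + X * (q * q) ^ suc N * D)
      ≈⟨ +-cong (*-congˡ (Σ-last N f)) (trans (Σ-last (suc N) g) (+-congˡ (*-congʳ (^-distrib-* x (q * q) (suc N))))) ⟨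
    x * Σ< (suc N) f + Σ< (suc (suc N)) g ∎
    where
    f g : ℕ → Carrier
    f i = x ^ i * (r i * c i)
    g i = (x * (q * q)) ^ i * (r i * c i)
    X D : Carrier
    X = x ^ suc N
    D = r (suc N) * c (suc N)

  -- Euler's expansion is used only through this functional equation of 1/(x;q²)_∞ and the value
  -- `E-zero`; together they determine `E` at the powers of q that occur.
  E-shift : ∀ k → E (q ^ suc k) ≈ u (suc k) * E (q ^ (3 ℕ.+ k))
  E-shift k = trans (divide k equation) (*-comm (E x′) (u (suc k)))
    where
    x x′ : Carrier
    x = q ^ suc k
    x′ = q ^ (3 ℕ.+ k)
    f : ℕ → Carrier
    f i = x ^ i * (r i * c i)
    x*E : x * Σ< L f ≈ x * E x
    x*E = sym (begin
      x * E x                              ≈⟨ *-congˡ (Σ-last L f) ⟩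
      x * (Σ< L f + x ^ L * (r L * c L))
        ≈⟨ solve 4 (λ x S P d → x :* (S :+ P :* d) := x :* S :+ x :* P :* d) refl x (Σ< L f) (x ^ L) (r L * c L) ⟩
      x * Σ< L f + x ^ K * (r L * c L)     ≈⟨ +-congˡ (trans (*-congʳ ([q^k]^K≈0 k)) (zeroˡ _)) ⟩
      x * Σ< L f + 0#                      ≈⟨ +-identityʳ _ ⟩
      x * Σ< L f                           ∎)
    x*q²≈x′ : x * (q * q) ≈ x′
    x*q²≈x′ = solve 2 (λ q x → x :* (q :* q) := q :* (q :* x)) refl q x
    equation : E x ≈ E x′ + x * E x
    equation = trans (E-shift-finite x L) (trans (+-comm _ _) (+-cong
      (Σ-cong K {λ i → (x * (q * q)) ^ i * (r i * c i)} {λ i → x′ ^ i * (r i * c i)}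
        (λ i _ → *-congʳ (^-congˡ i x*q²≈x′))) x*E))

  E-zero : ∀ {x} → x ≈ 0# → E x ≈ 1#
  E-zero {x} x≈0 = begin
    1# * (1# * 1#) + Σ< L (λ i → x * x ^ i * (r (suc i) * c (suc i)))
      ≈⟨ +-cong (solve 0 (con 1 :* (con 1 :* con 1) := con 1) refl)
           (Σ-zero L {λ i → x * x ^ i * (r (suc i) * c (suc i))} (λ i _ → trans (*-congʳ (trans (*-congʳ x≈0) (zeroˡ _))) (zeroˡ _))) ⟩
    1# + 0#                                      ≈⟨ +-identityʳ _ ⟩
    1#                                           ∎

  -- κ s = 1/(q^s;q)_∞ and ρ m = 1/(q^(2m+2);q²)_m, so q^(2m) * y m is the m-th term of Σ G(n) q^n.
  κ ρ y ŷ : ℕ → Carrier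
  κ s = Π< K (λ i → u (s ℕ.+ i))
  ρ m = Π< m (λ i → u ((suc m ℕ.+ i) ℕ.* 2))
  y m = κ (m ℕ.* 2) * ρ m
  ŷ m = e * (c (m ℕ.* 2) * E (q ^ (m ℕ.* 2)))

  κ-suc : ∀ s → κ s ≈ u s * κ (suc s)
  κ-suc s = *-cong (reflexive (≡.cong u (ℕ.+-identityʳ s))) (begin
    Π< L (λ i → u (s ℕ.+ suc i))
      ≈⟨ Π-cong L {λ i → u (s ℕ.+ suc i)} {λ i → u (suc s ℕ.+ i)} (λ i _ → reflexive (≡.cong u (ℕ.+-suc s i))) ⟩
    Π< L (λ i → u (suc s ℕ.+ i))                  ≈⟨ *-identityʳ _ ⟨
    -- The window of `K` factors moves up by one place; the factor that enters is 1 because its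
    -- exponent is at least `K`.
    Π< L (λ i → u (suc s ℕ.+ i)) * 1#             ≈⟨ *-congˡ (u-high _ (s≤s (ℕ.m≤n+m L s))) ⟨
    Π< L (λ i → u (suc s ℕ.+ i)) * u (suc s ℕ.+ L) ≈⟨ Π-last L (λ i → u (suc s ℕ.+ i)) ⟨
    κ (suc s)                                     ∎)

  κ-high : ∀ s → K ≤ s → κ s ≈ 1#
  κ-high s K≤s = Π-one K {λ i → u (s ℕ.+ i)} (λ i _ → u-high _ (ℕ.≤-trans K≤s (ℕ.m≤m+n s i)))

  ρ-high : ∀ m → K ≤ m → ρ m ≈ 1#
  ρ-high m K≤m = Π-one m {λ i → u ((suc m ℕ.+ i) ℕ.* 2)}
    (λ i _ → u-high _ (ℕ.≤-trans K≤m (ℕ.≤-trans (ℕ.n≤1+n m) (ℕ.≤-trans (ℕ.m≤m+n (suc m) i) (ℕ.m≤m*n _ 2)))))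

  -- The exponents in `ρ m` are 2m+2, ..., 4m and those in `ρ (suc m)` are 2m+4, ..., 4m+4: the
  -- factor at 2m+2 leaves, those at 4m+2 and 4m+4 enter. `u-double` splits the two newcomers, and
  -- one of the pieces is again the factor at 2m+2.
  ρ-suc : ∀ m → ρ m * (u (suc (m ℕ.* 2)) * (v (suc (m ℕ.* 2)) * v (suc m ℕ.* 2))) ≈ ρ (suc m)
  ρ-suc m = u-cancel (suc (m ℕ.* 2)) (begin
    U₂ * (ρ m * (U₁ * (V₁ * V₂)))
      ≈⟨ solve 5 (λ ρ U₁ U₂ V₁ V₂ → U₂ :* (ρ :* (U₁ :* (V₁ :* V₂))) :=
           ρ :* (U₁ :* V₁) :* (U₂ :* V₂)) refl (ρ m) U₁ U₂ V₁ V₂ ⟩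
    ρ m * (U₁ * V₁) * (U₂ * V₂)
      ≈⟨ *-cong (*-congˡ (u-double (m ℕ.* 2))) (u-double (suc (m ℕ.* 2))) ⟨
    ρ m * u (suc (m ℕ.* 2) ℕ.* 2) * u ((suc m ℕ.* 2) ℕ.* 2)
                                            ≈⟨ *-cong (*-congˡ (reflexive (≡.cong (λ k → u (suc k ℕ.* 2)) m*2≡m+m)))
                                                 (reflexive (≡.cong (λ k → u (suc k ℕ.* 2)) (≡.trans (≡.cong suc m*2≡m+m) (≡.sym (ℕ.+-suc m m))))) ⟩
    ρ m * w m * w (suc m)                   ≈⟨ *-congʳ (Π-last m w) ⟨
    Π< (suc m) w * w (suc m)                ≈⟨ Π-last (suc m) w ⟨
    w 0 * Π< (suc m) (λ i → w (suc i))
      ≈⟨ *-cong (reflexive (≡.cong (λ k → u (suc k ℕ.* 2)) (ℕ.+-identityʳ m)))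
                                                 (Π-cong (suc m) {λ i → w (suc i)} {λ i → u ((suc (suc m) ℕ.+ i) ℕ.* 2)} (λ i _ → reflexive (≡.cong (λ k → u (suc k ℕ.* 2)) (ℕ.+-suc m i)))) ⟩
    U₂ * ρ (suc m)                          ∎)
    where
    U₁ U₂ V₁ V₂ : Carrier
    U₁ = u (suc (m ℕ.* 2))
    U₂ = u (suc m ℕ.* 2)
    V₁ = v (suc (m ℕ.* 2))
    V₂ = v (suc m ℕ.* 2)
    w : ℕ → Carrier
    w i = u ((suc m ℕ.+ i) ℕ.* 2)
    m*2≡m+m : m ℕ.* 2 ≡ m ℕ.+ m
    m*2≡m+m = ≡.trans (ℕ.*-comm m 2) (≡.cong (m ℕ.+_) (ℕ.+-identityʳ m))

  y-rec : ∀ m → y m * v (suc (m ℕ.* 2)) * v (suc m ℕ.* 2) ≈ u (m ℕ.* 2) * y (suc m)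
  y-rec m = begin
    κ (m ℕ.* 2) * ρ m * V₁ * V₂
      ≈⟨ *-congʳ (*-congʳ (*-congʳ (trans (κ-suc (m ℕ.* 2)) (*-congˡ (κ-suc (suc (m ℕ.* 2))))))) ⟩
    u (m ℕ.* 2) * (U₁ * κ (suc m ℕ.* 2)) * ρ m * V₁ * V₂
      ≈⟨ solve 6 (λ u U k ρ V W → u :* (U :* k) :* ρ :* V :* W := u :* (k :* (ρ :* (U :* (V :* W))))) refl _ _ _ _ _ _ ⟩
    u (m ℕ.* 2) * (κ (suc m ℕ.* 2) * (ρ m * (U₁ * (V₁ * V₂))))
      ≈⟨ *-congˡ (*-congˡ (ρ-suc m)) ⟩
    u (m ℕ.* 2) * y (suc m) ∎
    where
    U₁ V₁ V₂ : Carrier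
    U₁ = u (suc (m ℕ.* 2))
    V₁ = v (suc (m ℕ.* 2))
    V₂ = v (suc m ℕ.* 2)

  -- The counterpart of `y-rec`, here for a positive index because `E-shift` needs a positive
  -- exponent.
  ŷ-rec : ∀ m → ŷ (suc m) * v (suc (suc m ℕ.* 2)) * v (suc (suc m) ℕ.* 2) ≈ u (suc m ℕ.* 2) * ŷ (suc (suc m))
  ŷ-rec m = begin
    e * (c k * E (q ^ k)) * v (suc k) * v (suc (suc k))
      ≈⟨ *-congʳ (*-congʳ (*-congˡ (*-congˡ (E-shift (suc (m ℕ.* 2)))))) ⟩
    e * (c k * (u k * E (q ^ suc (suc k)))) * v (suc k) * v (suc (suc k))
      ≈⟨ solve 6 (λ e c u E V W → e :* (c :* (u :* E)) :* V :* W := u :* (e :* (c :* V :* W :* E))) refl _ _ _ _ _ _ ⟩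
    u k * (e * (c k * v (suc k) * v (suc (suc k)) * E (q ^ suc (suc k))))
      ≈⟨ *-congˡ (*-congˡ (*-congʳ (trans (Π-last (suc k) (λ i → v (suc i))) (*-congʳ (Π-last k (λ i → v (suc i))))))) ⟨
    u k * ŷ (suc (suc m)) ∎
    where
    k : ℕ
    k = suc m ℕ.* 2

  -- Both sides obey the same two-step recursion and equal 1 for large m.
  y≈ŷ : ∀ d m → K ≤ suc m ℕ.+ d → y (suc m) ≈ ŷ (suc m)
  y≈ŷ zero m K≤m+0 = begin
    y (suc m)                                  ≈⟨ *-cong (κ-high _ K≤2m) (ρ-high _ K≤m) ⟩
    1# * 1#                                    ≈⟨ *-congʳ (e*c≈1 (suc m ℕ.* 2 ℕ.∸ L)) ⟨
    e * c (L ℕ.+ (suc m ℕ.* 2 ℕ.∸ L)) * 1#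
      ≈⟨ *-congʳ (*-congˡ (reflexive (≡.cong c (ℕ.m+[n∸m]≡n (ℕ.≤-trans (ℕ.n≤1+n L) K≤2m))))) ⟩
    e * c (suc m ℕ.* 2) * 1#                   ≈⟨ *-assoc _ _ _ ⟩
    e * (c (suc m ℕ.* 2) * 1#)                 ≈⟨ *-congˡ (*-congˡ (E-zero (q^-high _ K≤2m))) ⟨
    ŷ (suc m)                                  ∎
    where
    K≤m : K ≤ suc m
    K≤m = ℕ.≤-trans K≤m+0 (ℕ.≤-reflexive (ℕ.+-identityʳ (suc m)))
    K≤2m : K ≤ suc m ℕ.* 2
    K≤2m = ℕ.≤-trans K≤m (ℕ.m≤m*n (suc m) 2)
  y≈ŷ (suc d) m K≤ = v-cancel (suc m ℕ.* 2) (v-cancel (suc (suc m ℕ.* 2)) (begin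
    y (suc m) * v (suc (suc m ℕ.* 2)) * v (suc (suc m) ℕ.* 2)  ≈⟨ y-rec (suc m) ⟩
    u (suc m ℕ.* 2) * y (suc (suc m))
      ≈⟨ *-congˡ (y≈ŷ d (suc m) (ℕ.≤-trans K≤ (ℕ.≤-reflexive (ℕ.+-suc (suc m) d)))) ⟩
    u (suc m ℕ.* 2) * ŷ (suc (suc m))                          ≈⟨ ŷ-rec m ⟨
    ŷ (suc m) * v (suc (suc m ℕ.* 2)) * v (suc (suc m) ℕ.* 2)  ∎))

  -- Once `E` is expanded, the pair (m, i) carries q^(2m(i+1)). Read as a power of t = q^(i+1), it
  -- lets the sum over m be taken first, and that sum is `evenPart` at t.
  Σy≈ΣT : Σ< n (λ m → q ^ (suc m ℕ.* 2) * y (suc m)) ≈ e * Σ< K T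
  Σy≈ΣT = begin
    Σ< n (λ m → q ^ (suc m ℕ.* 2) * y (suc m))
      ≈⟨ Σ-cong n {λ m → q ^ (suc m ℕ.* 2) * y (suc m)} {λ m → e * Σ< K (term m)} (λ m _ → step m) ⟩
    Σ< n (λ m → e * Σ< K (term m))
      ≈⟨ *-distribˡ-Σ n e (λ m → Σ< K (term m)) ⟨
    e * Σ< n (λ m → Σ< K (term m))
      ≈⟨ *-congˡ (Σ-swap n K term) ⟩
    e * Σ< K (λ i → Σ< n (λ m → term m i))
      ≈⟨ *-congˡ (Σ-cong K {λ i → Σ< n (λ m → term m i)} {T} (λ i _ → inner i)) ⟩
    e * Σ< K T ∎
    where
    term : ℕ → ℕ → Carrier
    term m i = r i * (c i * ((q ^ suc i) ^ (suc m ℕ.* 2) * c (suc m ℕ.* 2)))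
    inner : ∀ i → Σ< n (λ m → term m i) ≈ T i
    inner i =
      sym (trans (*-congˡ (*-distribˡ-Σ n (c i) (λ m → (q ^ suc i) ^ (suc m ℕ.* 2) * c (suc m ℕ.* 2)))) (*-distribˡ-Σ n (r i) (λ m → c i * ((q ^ suc i) ^ (suc m ℕ.* 2) * c (suc m ℕ.* 2)))))
    step : ∀ m → q ^ (suc m ℕ.* 2) * y (suc m) ≈ e * Σ< K (term m)
    step m = begin
      Q * y (suc m)                ≈⟨ *-congˡ (y≈ŷ K m (ℕ.m≤n+m K (suc m))) ⟩
      Q * (e * (c k * E Q))
        ≈⟨ solve 4 (λ Q e c E → Q :* (e :* (c :* E)) := e :* (Q :* c :* E)) refl Q e (c k) (E Q) ⟩
      e * (Q * c k * E Q)          ≈⟨ *-congˡ (*-distribˡ-Σ K (Q * c k) (λ i → Q ^ i * (r i * c i))) ⟩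
      e * Σ< K (λ i → Q * c k * (Q ^ i * (r i * c i)))
        ≈⟨ *-congˡ (Σ-cong K {λ i → Q * c k * (Q ^ i * (r i * c i))} {term m} (λ i _ → begin
             Q * c k * (Q ^ i * (r i * c i))
               ≈⟨ solve 5 (λ Q C P r c → Q :* C :* (P :* (r :* c)) :=
                    r :* (c :* (Q :* P :* C))) refl Q (c k) (Q ^ i) (r i) (c i) ⟩
             r i * (c i * (Q ^ suc i * c k))       ≈⟨ *-congˡ (*-congˡ (*-congʳ (^-comm k (suc i)))) ⟩
             term m i                              ∎)) ⟩
      e * Σ< K (term m)            ∎
      where
      k : ℕ
      k = suc m ℕ.* 2
      Q : Carrier
      Q = q ^ k
      ^-comm : ∀ a b → (q ^ a) ^ b ≈ (q ^ b) ^ a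
      ^-comm a b = trans (^-assocʳ q a b) (trans (^-congʳ q (ℕ.*-comm a b)) (sym (^-assocʳ q b a)))

  q-identity : 4# * Σ< n (λ m → q ^ (suc m ℕ.* 2) * y (suc m)) + β 0 ≈ r L
  q-identity = trans (+-congʳ (*-congˡ Σy≈ΣT)) telescoped

-- Weighted generating functions of partitions

Weight : Set
Weight = List ℕ → ℤ

ind : {P : Set} → Dec P → ℤ
ind d = if does d then 1ℤ else 0ℤ

ind-yes : {P : Set} (d : Dec P) → P → ind d ≡ 1ℤ
ind-yes (yes _) _ = ≡.refl
ind-yes (no ¬p) p = ⊥-elim (¬p p)

ind-no : {P : Set} (d : Dec P) → ¬ P → ind d ≡ 0ℤ
ind-no (yes p) ¬p = ⊥-elim (¬p p)
ind-no (no _) _ = ≡.refl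

ind-× : {P Q S : Set} (d : Dec S) (d₁ : Dec P) (d₂ : Dec Q) → does d ≡ does d₁ ∧ does d₂ → ind d ≡ ind d₁ ℤ.* ind d₂
ind-× d d₁ d₂ eq with does d₁ | does d₂
... | false | _ rewrite eq = ≡.refl
... | true | false rewrite eq = ≡.refl
... | true | true rewrite eq = ≡.refl

[m+m]*2≡4*m : ∀ m → (m ℕ.+ m) ℕ.* 2 ≡ 4 ℕ.* m
[m+m]*2≡4*m = ℕ-Solver.solve-∀

sgn : ℕ → ℤ
sgn zero = 1ℤ
sgn (suc k) = ℤ.- sgn k

RedPart : ℕ → ℕ → Set
RedPart m x = (x % 2 ≡ 0) × (2 ℕ.* m < x) × (x ≤ 4 ℕ.* m)

redPart? : ∀ m → Decidable (RedPart m)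
redPart? m x = (x % 2 ℕ.≟ 0) ×-dec ((2 ℕ.* m ℕ.<? x) ×-dec (x ℕ.≤? 4 ℕ.* m))

-- In `rankSignWeight` the exponent of -1 is the sum of largest part and length; it has the parity
-- of the rank and avoids truncated subtraction.
oneWeight signWeight rankSignWeight isEmpty : Weight
oneWeight _ = 1ℤ
signWeight p = sgn (length p)
rankSignWeight p = sgn (largest p) ℤ.* sgn (length p)
isEmpty [] = 1ℤ
isEmpty (_ ∷ _) = 0ℤ

redWeight smallestWeight lengthWeight : ℕ → Weight
redWeight m p = ind (all? (redPart? m) p)
smallestWeight s p = ind (smallest p ℕ.≟ s)
lengthWeight l p = ind (length p ℕ.≟ l)

boxWeight : ℕ → ℕ → Weight
boxWeight a l p = ind (largest p ℕ.≟ a) ℤ.* ind (length p ℕ.≟ l)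

redWeight-∷ : ∀ m x p → redWeight m (x ∷ p) ≡ ind (redPart? m x) ℤ.* redWeight m p
redWeight-∷ m x p = ind-× (all? (redPart? m) (x ∷ p)) (redPart? m x) (all? (redPart? m) p) ≡.refl

-- A part put on top changes the smallest part only when it is the sole part. The target is a
-- successor because `smallest []` is 0 and the empty partition must have weight 0.
smallestWeight-∷ : ∀ s x p → smallestWeight (suc s) (x ∷ p) ≡ smallestWeight (suc s) p ℤ.+ ind (x ℕ.≟ suc s) ℤ.* isEmpty p
smallestWeight-∷ s x [] = ≡.sym (≡.trans (ℤ.+-identityˡ _) (ℤ.*-identityʳ _))
smallestWeight-∷ s x (y ∷ p) =
  ≡.sym (≡.trans (≡.cong (λ z → smallestWeight (suc s) (y ∷ p) ℤ.+ z) (ℤ.*-zeroʳ (ind (x ℕ.≟ suc s)))) (ℤ.+-identityʳ _))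

-- Axioms for `gf w b` as the sum of w(p) q^|p| over the partitions p with parts at most b. `gf-suc`
-- asks whether the largest part is b + 1; the bound stays at b + 1 after its removal because parts
-- may repeat.
record IsGeneratingFunction {a ℓ : Level} (R : CommutativeRing a ℓ) (q : CommutativeRing.Carrier R)
  (gf : Weight → ℕ → CommutativeRing.Carrier R) : Set (a ⊔ ℓ) where
  open CommutativeRing R hiding (zero)
  open Exp commutativeSemiring using (_^_)
  field
    gf-cong : ∀ {w w′} → (∀ p → w p ≡ w′ p) → ∀ b → gf w b ≈ gf w′ b
    gf-0 : ∀ b → gf (λ _ → 0ℤ) b ≈ 0#
    gf-+ : ∀ w w′ b → gf (λ p → w p ℤ.+ w′ p) b ≈ gf w b + gf w′ b
    gf-neg : ∀ w b → gf (λ p → ℤ.- w p) b ≈ - gf w b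
    gf-nil₀ : ∀ {w} → w [] ≡ 0ℤ → gf w 0 ≈ 0#
    gf-nil₁ : ∀ {w} → w [] ≡ 1ℤ → gf w 0 ≈ 1#
    gf-suc : ∀ w b → gf w (suc b) ≈ gf w b + q ^ suc b * gf (λ p → w (suc b ∷ p)) (suc b)

module WeightedCounts {a ℓ : Level} (R : CommutativeRing a ℓ) (q : CommutativeRing.Carrier R) (n : ℕ)
  (q-nilpotent : CommutativeRing._≈_ R (Exp._^_ (CommutativeRing.commutativeSemiring R) q (suc (n ℕ.* 2))) (CommutativeRing.0# R))
  (gf : Weight → ℕ → CommutativeRing.Carrier R) (isGF : IsGeneratingFunction R q gf)
  where
  open CommutativeRing R hiding (zero)
  open Exp commutativeSemiring using (_^_; ^-distrib-*; ^-homo-*; ^-congʳ)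
  open QIdentity R q n q-nilpotent
  open IsGeneratingFunction isGF
  open RingProperties ring using (+-cancelʳ; -1*x≈-x)
  open NatSolver commutativeSemiring using (solve; _:+_; _:*_; _:=_; con)
  open SetoidReasoning setoid

  -- Signs and the parity of the rank

  gf-suc-const : ∀ w b → (∀ p → w (suc b ∷ p) ≡ 0ℤ) → gf w (suc b) ≈ gf w b
  gf-suc-const w b w≡0 = begin
    gf w (suc b)                                         ≈⟨ gf-suc w b ⟩
    gf w b + q ^ suc b * gf (λ p → w (suc b ∷ p)) (suc b)
      ≈⟨ +-congˡ (*-congˡ (trans (gf-cong w≡0 (suc b)) (gf-0 (suc b)))) ⟩
    gf w b + q ^ suc b * 0#                              ≈⟨ trans (+-congˡ (zeroʳ _)) (+-identityʳ _) ⟩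
    gf w b                                               ∎

  gf-suc-same : ∀ w b → (∀ p → w (suc b ∷ p) ≡ w p) → gf w (suc b) ≈ gf w b * u (suc b)
  gf-suc-same w b w≡w = divide b (trans (gf-suc w b) (+-congˡ (*-congˡ (gf-cong w≡w (suc b)))))

  gf-one : ∀ b → gf oneWeight b ≈ r b
  gf-one zero = gf-nil₁ ≡.refl
  gf-one (suc b) = begin
    gf oneWeight (suc b)          ≈⟨ gf-suc-same oneWeight b (λ _ → ≡.refl) ⟩
    gf oneWeight b * u (suc b)    ≈⟨ *-congʳ (gf-one b) ⟩
    r b * u (suc b)               ≈⟨ Π-last b (λ i → u (suc i)) ⟨
    r (suc b)                     ∎

  gf-neg′ : ∀ w b → gf (λ p → ℤ.- w p) b ≈ -1# * gf w b
  gf-neg′ w b = trans (gf-neg w b) (sym (-1*x≈-x _))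

  gf-sgn : ∀ k w b → gf (λ p → sgn k ℤ.* w p) b ≈ -1# ^ k * gf w b
  gf-sgn zero w b = trans (gf-cong (λ p → ℤ.*-identityˡ (w p)) b) (sym (*-identityˡ _))
  gf-sgn (suc k) w b = begin
    gf (λ p → ℤ.- sgn k ℤ.* w p) b        ≈⟨ gf-cong (λ p → ≡.sym (ℤ.neg-distribˡ-* (sgn k) (w p))) b ⟩
    gf (λ p → ℤ.- (sgn k ℤ.* w p)) b      ≈⟨ gf-neg′ (λ p → sgn k ℤ.* w p) b ⟩
    -1# * gf (λ p → sgn k ℤ.* w p) b      ≈⟨ *-congˡ (gf-sgn k w b) ⟩
    -1# * (-1# ^ k * gf w b)              ≈⟨ *-assoc _ _ _ ⟨
    -1# ^ suc k * gf w b                  ∎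

  -- Every part carries a sign, so the size b + 1 contributes 1/(1 + q^(b+1)).
  gf-sign : ∀ b → gf signWeight b ≈ c b
  gf-sign zero = gf-nil₁ ≡.refl
  gf-sign (suc b) = begin
    S                            ≈⟨ trans (*-congˡ (v-eq b)) (*-identityʳ _) ⟨
    S * (V + Q * V)              ≈⟨ solve 3 (λ S V Q → S :* (V :+ Q :* V) := (S :+ Q :* S) :* V) refl S V Q ⟩
    (S + Q * S) * V              ≈⟨ *-congʳ equation ⟩
    gf signWeight b * V          ≈⟨ *-congʳ (gf-sign b) ⟩
    c b * V                      ≈⟨ Π-last b (λ i → v (suc i)) ⟨
    c (suc b)                    ∎
    where
    S Q V : Carrier
    S = gf signWeight (suc b)
    Q = q ^ suc b
    V = v (suc b)
    equation : S + Q * S ≈ gf signWeight b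
    equation = begin
      S + Q * S
        ≈⟨ +-congʳ (trans (gf-suc signWeight b) (+-congˡ (*-congˡ (gf-neg′ signWeight (suc b))))) ⟩
      gf signWeight b + Q * (-1# * S) + Q * S
        ≈⟨ solve 4 (λ G Q m S → G :+ Q :* (m :* S) :+ Q :* S :=
             G :+ (Q :* S :+ m :* (Q :* S))) refl (gf signWeight b) Q -1# S ⟩
      gf signWeight b + (Q * S + -1# * (Q * S))     ≈⟨ trans (+-congˡ (x+-1x≈0 _)) (+-identityʳ _) ⟩
      gf signWeight b                               ∎

  -- Sort by the largest part k. For k ≥ 1 the sign of k, the sign of that part itself and `gf-sign`
  -- at bound k give -(-q)^k `c k`, which the sum cancels; the empty partition and the term of index
  -- 0 leave 1 + 1.
  gf-rankSign-finite : ∀ b → gf rankSignWeight b + Σ< (suc b) (λ i → (-1# * q) ^ i * c i) ≈ 2#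
  gf-rankSign-finite zero =
    trans (+-congʳ (gf-nil₁ ≡.refl)) (solve 0 (con 1 :+ (con 1 :* con 1 :+ con 0) := con 1 :+ con 1) refl)
  gf-rankSign-finite (suc b) = begin
    gf rankSignWeight (suc b) + Σ< (suc (suc b)) f
      ≈⟨ +-cong (gf-suc rankSignWeight b) (Σ-last (suc b) f) ⟩
    (W + Q * gf (λ p → sgn (suc b) ℤ.* ℤ.- signWeight p) (suc b)) + (S + (-1# * q) ^ suc b * C)
      ≈⟨ +-cong (+-congˡ (*-congˡ (trans (gf-sgn (suc b) (λ p → ℤ.- signWeight p) (suc b)) (*-congˡ (trans (gf-neg′ signWeight (suc b)) (*-congˡ (gf-sign (suc b))))))))
                (+-congˡ (*-congʳ (^-distrib-* -1# q (suc b)))) ⟩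
    (W + Q * (-1# ^ suc b * (-1# * C))) + (S + -1# ^ suc b * Q * C)
      ≈⟨ solve 6 (λ W Q P m C S → (W :+ Q :* (P :* (m :* C))) :+ (S :+ P :* Q :* C) :=
           (W :+ S) :+ (P :* Q :* C :+ m :* (P :* Q :* C))) refl W Q (-1# ^ suc b) -1# C S ⟩
    (W + S) + (-1# ^ suc b * Q * C + -1# * (-1# ^ suc b * Q * C))
      ≈⟨ trans (+-congˡ (x+-1x≈0 _)) (+-identityʳ _) ⟩
    W + S
      ≈⟨ gf-rankSign-finite b ⟩
    2# ∎
    where
    f : ℕ → Carrier
    f i = (-1# * q) ^ i * c i
    W Q S C : Carrier
    W = gf rankSignWeight b
    Q = q ^ suc b
    S = Σ< (suc b) f
    C = c (suc b)

  gf-rankSign : gf rankSignWeight L ≈ β 0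
  gf-rankSign = +-cancelʳ B _ _ (begin
    gf rankSignWeight L + B     ≈⟨ gf-rankSign-finite L ⟩
    2#                          ≈⟨ +-identityʳ _ ⟨
    2# + 0#                     ≈⟨ +-congˡ (x+-1x≈0 B) ⟨
    2# + (B + -1# * B)
      ≈⟨ solve 2 (λ B m → con 1 :+ con 1 :+ (B :+ m) := con 1 :+ con 1 :+ m :+ B) refl B (-1# * B) ⟩
    β 0 + B                     ∎)
    where
    B : Carrier
    B = Y (-1# * q)

  -- Red parts

  gf-red-skip : ∀ m b → ¬ RedPart m (suc b) → gf (redWeight m) (suc b) ≈ gf (redWeight m) b
  gf-red-skip m b ¬red = gf-suc-const (redWeight m) b
    (λ p → ≡.trans (redWeight-∷ m (suc b) p) (≡.cong (ℤ._* redWeight m p) (ind-no (redPart? m (suc b)) ¬red)))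

  gf-red-take : ∀ m b → RedPart m (suc b) → gf (redWeight m) (suc b) ≈ gf (redWeight m) b * u (suc b)
  gf-red-take m b red = gf-suc-same (redWeight m) b
    (λ p → ≡.trans (redWeight-∷ m (suc b) p) (≡.trans (≡.cong (ℤ._* redWeight m p) (ind-yes (redPart? m (suc b)) red)) (ℤ.*-identityˡ _)))

  gf-red-low : ∀ m b → b ≤ m ℕ.* 2 → gf (redWeight m) b ≈ 1#
  gf-red-low m zero _ = gf-nil₁ ≡.refl
  gf-red-low m (suc b) b<2m = trans
    (gf-red-skip m b (λ { (_ , 2m<b , _) → ℕ.<⇒≱ 2m<b (ℕ.≤-trans b<2m (ℕ.≤-reflexive (ℕ.*-comm m 2))) }))
    (gf-red-low m b (ℕ.≤-trans (ℕ.n≤1+n b) b<2m))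

  -- The bound grows by two sizes at a time: the odd one is not allowed, the even one contributes a
  -- factor, and k ≤ m keeps it within 4m.
  gf-red-mid : ∀ m k → k ≤ m → gf (redWeight m) ((m ℕ.+ k) ℕ.* 2) ≈ Π< k (λ i → u ((suc m ℕ.+ i) ℕ.* 2))
  gf-red-mid m zero _ = gf-red-low m _ (ℕ.≤-reflexive (≡.cong (ℕ._* 2) (ℕ.+-identityʳ m)))
  gf-red-mid m (suc k) k<m rewrite ℕ.+-suc m k = begin
    gf (redWeight m) (suc (suc (j ℕ.* 2)))
      ≈⟨ gf-red-take m (suc (j ℕ.* 2)) (m*n%n≡0 (suc j) 2 , 2m< , ≤4m) ⟩
    gf (redWeight m) (suc (j ℕ.* 2)) * u (suc j ℕ.* 2)
      ≈⟨ *-congʳ (gf-red-skip m (j ℕ.* 2) (λ { (even , _) → odd even })) ⟩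
    gf (redWeight m) (j ℕ.* 2) * u (suc j ℕ.* 2)
      ≈⟨ *-congʳ (gf-red-mid m k (ℕ.≤-trans (ℕ.n≤1+n k) k<m)) ⟩
    Π< k (λ i → u ((suc m ℕ.+ i) ℕ.* 2)) * u (suc j ℕ.* 2)
      ≈⟨ Π-last k (λ i → u ((suc m ℕ.+ i) ℕ.* 2)) ⟨
    Π< (suc k) (λ i → u ((suc m ℕ.+ i) ℕ.* 2)) ∎
    where
    j : ℕ
    j = m ℕ.+ k
    odd : suc (j ℕ.* 2) % 2 ≢ 0
    odd even with ≡.trans (≡.sym ([m+kn]%n≡m%n 1 j 2)) even
    ... | ()
    2m< : 2 ℕ.* m < suc j ℕ.* 2
    2m< =
      ℕ.<-≤-trans (s≤s (ℕ.≤-reflexive (ℕ.*-comm 2 m))) (s≤s (ℕ.≤-trans (ℕ.*-monoˡ-≤ 2 (ℕ.m≤m+n m k)) (ℕ.n≤1+n _)))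
    ≤4m : suc j ℕ.* 2 ≤ 4 ℕ.* m
    ≤4m =
      ℕ.≤-trans (ℕ.*-monoˡ-≤ 2 (ℕ.≤-trans (ℕ.≤-reflexive (≡.sym (ℕ.+-suc m k))) (ℕ.+-monoʳ-≤ m k<m))) (ℕ.≤-reflexive ([m+m]*2≡4*m m))

  gf-red : ∀ m d → gf (redWeight m) ((m ℕ.+ m) ℕ.* 2 ℕ.+ d) ≈ ρ m
  gf-red m zero = trans (reflexive (≡.cong (gf (redWeight m)) (ℕ.+-identityʳ _))) (gf-red-mid m m ℕ.≤-refl)
  gf-red m (suc d) rewrite ℕ.+-suc ((m ℕ.+ m) ℕ.* 2) d = trans
    (gf-red-skip m _ (λ { (_ , _ , ≤4m) → ℕ.<⇒≱ (s≤s (ℕ.≤-trans (ℕ.≤-reflexive (≡.sym ([m+m]*2≡4*m m))) (ℕ.m≤m+n _ d))) ≤4m }))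
    (gf-red m d)

  -- Blue parts with prescribed smallest part

  gf-isEmpty : ∀ b → gf isEmpty b ≈ 1#
  gf-isEmpty zero = gf-nil₁ ≡.refl
  gf-isEmpty (suc b) = trans (gf-suc-const isEmpty b (λ _ → ≡.refl)) (gf-isEmpty b)

  gf-smallest-other : ∀ s b → b ≢ s → gf (smallestWeight (suc s)) (suc b) ≈ gf (smallestWeight (suc s)) b * u (suc b)
  gf-smallest-other s b b≢s =
    gf-suc-same (smallestWeight (suc s)) b (λ p → ≡.trans (smallestWeight-∷ s (suc b) p)
    (≡.trans (≡.cong (λ z → smallestWeight (suc s) p ℤ.+ z ℤ.* isEmpty p) (ind-no (suc b ℕ.≟ suc s) (λ eq → b≢s (ℕ.suc-injective eq)))) (ℤ.+-identityʳ _)))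

  gf-smallest-low : ∀ s b → b ≤ s → gf (smallestWeight (suc s)) b ≈ 0#
  gf-smallest-low s zero _ = gf-nil₀ ≡.refl
  gf-smallest-low s (suc b) b<s =
    trans (gf-smallest-other s b (ℕ.<⇒≢ b<s)) (trans (*-congʳ (gf-smallest-low s b (ℕ.<⇒≤ b<s))) (zeroˡ _))

  -- The power q^(s+1) is the obligatory smallest part; the sizes from s + 1 up to the bound are
  -- then free and give one factor each.
  gf-smallest-high : ∀ s d → gf (smallestWeight (suc s)) (suc s ℕ.+ d) ≈ q ^ suc s * Π< (suc d) (λ i → u (suc s ℕ.+ i))
  gf-smallest-high s zero rewrite ℕ.+-identityʳ s = begin
    gf W (suc s)                               ≈⟨ divide s equation ⟩
    Q * u (suc s)                              ≈⟨ *-congˡ (*-identityʳ _) ⟨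
    Q * (u (suc s) * 1#)                       ∎
    where
    W : Weight
    W = smallestWeight (suc s)
    Q : Carrier
    Q = q ^ suc s
    step : ∀ p → W (suc s ∷ p) ≡ W p ℤ.+ isEmpty p
    step p = ≡.trans (smallestWeight-∷ s (suc s) p) (≡.cong (λ z → W p ℤ.+ z)
      (≡.trans (≡.cong (ℤ._* isEmpty p) (ind-yes (suc s ℕ.≟ suc s) ≡.refl)) (ℤ.*-identityˡ _)))
    equation : gf W (suc s) ≈ Q + Q * gf W (suc s)
    equation = begin
      gf W (suc s)                             ≈⟨ gf-suc W s ⟩
      gf W s + Q * gf (λ p → W (suc s ∷ p)) (suc s)
        ≈⟨ +-cong (gf-smallest-low s s ℕ.≤-refl) (*-congˡ (trans (gf-cong step (suc s)) (trans (gf-+ W isEmpty (suc s)) (+-congˡ (gf-isEmpty (suc s)))))) ⟩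
      0# + Q * (gf W (suc s) + 1#)
        ≈⟨ solve 2 (λ Q w → con 0 :+ Q :* (w :+ con 1) := Q :+ Q :* w) refl Q (gf W (suc s)) ⟩
      Q + Q * gf W (suc s)                     ∎
  gf-smallest-high s (suc d) = begin
    gf W (suc s ℕ.+ suc d)                     ≈⟨ reflexive (≡.cong (gf W) (ℕ.+-suc (suc s) d)) ⟩
    gf W (suc (suc s ℕ.+ d))
      ≈⟨ gf-smallest-other s (suc s ℕ.+ d) (λ eq → ℕ.<⇒≢ (s≤s (ℕ.m≤m+n s d)) (≡.sym eq)) ⟩
    gf W (suc s ℕ.+ d) * u (suc (suc s ℕ.+ d))
      ≈⟨ *-cong (gf-smallest-high s d) (reflexive (≡.cong u (≡.sym (ℕ.+-suc (suc s) d)))) ⟩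
    q ^ suc s * Π< (suc d) f * f (suc d)       ≈⟨ *-assoc _ _ _ ⟩
    q ^ suc s * (Π< (suc d) f * f (suc d))     ≈⟨ *-congˡ (Π-last (suc d) f) ⟨
    q ^ suc s * Π< (suc (suc d)) f             ∎
    where
    W : Weight
    W = smallestWeight (suc s)
    f : ℕ → Carrier
    f i = u (suc s ℕ.+ i)

  -- The bound is chosen so that there are exactly `K` factors, as in `κ`.
  gf-smallest : ∀ s → gf (smallestWeight (suc s)) (suc s ℕ.+ L) ≈ q ^ suc s * κ (suc s)
  gf-smallest s = gf-smallest-high s L

  -- The Gaussian binomial coefficient [a + l choose a].
  gauss : ℕ → ℕ → Carrier
  gauss zero l = 1#
  gauss (suc a) zero = 1#
  gauss (suc a) (suc l) = gauss a (suc l) + q ^ suc a * gauss (suc a) l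

  gauss-zero : ∀ a → gauss a zero ≈ 1#
  gauss-zero zero = refl
  gauss-zero (suc a) = refl

  -- The definition is one q-Pascal rule and this is the other; exchanging a and l exchanges the two
  -- rules, so `gauss-comm` becomes an induction.
  gauss-pascal : ∀ a l → gauss (suc a) (suc l) ≈ gauss (suc a) l + q ^ suc l * gauss a (suc l)
  gauss-pascal zero zero = refl
  gauss-pascal zero (suc l) = begin
    1# + q * 1# * gauss 1 (suc l)                      ≈⟨ +-congˡ (*-congˡ (gauss-pascal zero l)) ⟩
    1# + q * 1# * (gauss 1 l + q ^ suc l * 1#)
      ≈⟨ solve 3 (λ q g Q → con 1 :+ q :* con 1 :* (g :+ Q :* con 1) :=
           con 1 :+ q :* con 1 :* g :+ q :* Q :* con 1) refl q (gauss 1 l) (q ^ suc l) ⟩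
    gauss 1 (suc l) + q ^ suc (suc l) * 1#             ∎
  gauss-pascal (suc a) zero = begin
    gauss (suc a) 1 + q ^ suc (suc a) * 1#             ≈⟨ +-congʳ (gauss-pascal a zero) ⟩
    gauss (suc a) 0 + q * 1# * gauss a 1 + q ^ suc (suc a) * 1#
      ≈⟨ solve 4 (λ o q g Q → o :+ q :* con 1 :* g :+ q :* Q :* con 1 :=
           o :+ q :* con 1 :* (g :+ Q :* con 1)) refl 1# q (gauss a 1) (q ^ suc a) ⟩
    1# + q * 1# * (gauss a 1 + q ^ suc a * 1#)         ∎
  gauss-pascal (suc a) (suc l) = begin
    gauss (suc a) (suc (suc l)) + q * Qₐ * gauss (suc (suc a)) (suc l)
      ≈⟨ +-cong (gauss-pascal a (suc l)) (*-congˡ (gauss-pascal (suc a) l)) ⟩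
    gauss (suc a) (suc l) + q * Qₗ * gauss a (suc (suc l)) + q * Qₐ * (gauss (suc (suc a)) l + Qₗ * gauss (suc a) (suc l))
      ≈⟨ solve 7 (λ q A B x y z w → x :+ q :* B :* y :+ q :* A :* (z :+ B :* w) :=
           (x :+ q :* A :* z) :+ q :* B :* (y :+ A :* w)) refl
           q Qₐ Qₗ (gauss (suc a) (suc l)) (gauss a (suc (suc l))) (gauss (suc (suc a)) l) (gauss (suc a) (suc l)) ⟩
    gauss (suc (suc a)) (suc l) + q ^ suc (suc l) * gauss (suc a) (suc (suc l)) ∎
    where
    Qₐ Qₗ : Carrier
    Qₐ = q ^ suc a
    Qₗ = q ^ suc l

  gauss-comm : ∀ a l → gauss a l ≈ gauss l a
  gauss-comm zero l = sym (gauss-zero l)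
  gauss-comm (suc a) zero = refl
  gauss-comm (suc a) (suc l) = begin
    gauss a (suc l) + q ^ suc a * gauss (suc a) l
      ≈⟨ +-cong (gauss-comm a (suc l)) (*-congˡ (gauss-comm (suc a) l)) ⟩
    gauss (suc l) a + q ^ suc a * gauss l (suc a)   ≈⟨ gauss-pascal l a ⟨
    gauss (suc l) (suc a)                           ∎

  -- Partitions by largest part and number of parts

  gf-length-zero : ∀ a → gf (lengthWeight 0) a ≈ 1#
  gf-length-zero zero = gf-nil₁ ≡.refl
  gf-length-zero (suc a) = trans (gf-suc-const (lengthWeight 0) a (λ _ → ≡.refl)) (gf-length-zero a)

  -- Subtracting 1 from each of the l parts removes q^l and leaves a partition in an a × l box.
  gf-length : ∀ a l → gf (lengthWeight l) (suc a) ≈ q ^ l * gauss a l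
  gf-length a zero = trans (gf-length-zero (suc a)) (sym (trans (*-identityˡ _) (gauss-zero a)))
  gf-length zero (suc l) = begin
    gf (lengthWeight (suc l)) 1                               ≈⟨ gf-suc (lengthWeight (suc l)) 0 ⟩
    gf (lengthWeight (suc l)) 0 + q * 1# * gf (lengthWeight l) 1
      ≈⟨ +-cong (gf-nil₀ ≡.refl) (*-congˡ (gf-length zero l)) ⟩
    0# + q * 1# * (q ^ l * 1#)
      ≈⟨ solve 2 (λ q Q → con 0 :+ q :* con 1 :* (Q :* con 1) := q :* Q :* con 1) refl q (q ^ l) ⟩
    q ^ suc l * 1#                                            ∎
  gf-length (suc a) (suc l) = begin
    gf (lengthWeight (suc l)) (suc (suc a))                   ≈⟨ gf-suc (lengthWeight (suc l)) (suc a) ⟩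
    gf (lengthWeight (suc l)) (suc a) + q ^ suc (suc a) * gf (lengthWeight l) (suc (suc a))
      ≈⟨ +-cong (gf-length a (suc l)) (*-congˡ (gf-length (suc a) l)) ⟩
    q ^ suc l * gauss a (suc l) + q ^ suc (suc a) * (q ^ l * gauss (suc a) l)
      ≈⟨ solve 5 (λ q A P x y → q :* P :* x :+ q :* A :* (P :* y) :=
           q :* P :* (x :+ A :* y)) refl q (q ^ suc a) (q ^ l) (gauss a (suc l)) (gauss (suc a) l) ⟩
    q ^ suc l * gauss (suc a) (suc l) ∎

  gf-box-skip : ∀ a l b → suc b ≢ a → gf (boxWeight a l) (suc b) ≈ gf (boxWeight a l) b
  gf-box-skip a l b b≢a =
    gf-suc-const (boxWeight a l) b (λ p → ≡.cong (ℤ._* ind (suc (length p) ℕ.≟ l)) (ind-no (suc b ℕ.≟ a) b≢a))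

  gf-box-low : ∀ a l b → b ≤ a → gf (boxWeight (suc a) l) b ≈ 0#
  gf-box-low a l zero _ = gf-nil₀ ≡.refl
  gf-box-low a l (suc b) b<a =
    trans (gf-box-skip (suc a) l b (λ eq → ℕ.<⇒≢ b<a (ℕ.suc-injective eq))) (gf-box-low a l b (ℕ.<⇒≤ b<a))

  -- Removing the hook made of the first row and the first column, of size a + l + 1, leaves a
  -- partition in an a × l box.
  gf-box : ∀ a l d → gf (boxWeight (suc a) (suc l)) (suc a ℕ.+ d) ≈ q ^ (suc a ℕ.+ l) * gauss a l
  gf-box a l zero rewrite ℕ.+-identityʳ a = begin
    gf W (suc a)                                                  ≈⟨ gf-suc W a ⟩
    gf W a + q ^ suc a * gf (λ p → W (suc a ∷ p)) (suc a)
      ≈⟨ +-cong (gf-box-low a (suc l) a ℕ.≤-refl) (*-congˡ (trans (gf-cong step (suc a)) (gf-length a l))) ⟩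
    0# + q ^ suc a * (q ^ l * gauss a l)
      ≈⟨ trans (+-identityˡ _) (sym (*-assoc _ _ _)) ⟩
    q ^ suc a * q ^ l * gauss a l                                 ≈⟨ *-congʳ (^-homo-* q (suc a) l) ⟨
    q ^ (suc a ℕ.+ l) * gauss a l                                 ∎
    where
    W : Weight
    W = boxWeight (suc a) (suc l)
    step : ∀ p → W (suc a ∷ p) ≡ lengthWeight l p
    step p = ≡.trans (≡.cong (ℤ._* lengthWeight l p) (ind-yes (suc a ℕ.≟ suc a) ≡.refl)) (ℤ.*-identityˡ _)
  gf-box a l (suc d) rewrite ℕ.+-suc a d = trans
    (gf-box-skip (suc a) (suc l) (suc a ℕ.+ d) (λ eq → ℕ.<⇒≢ (s≤s (ℕ.m≤m+n (suc a) d)) (≡.sym eq)))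
    (gf-box a l d)

  gf-box-no-parts : ∀ a b → gf (boxWeight (suc a) 0) b ≈ 0#
  gf-box-no-parts a zero = gf-nil₀ ≡.refl
  gf-box-no-parts a (suc b) =
    trans (gf-suc-const (boxWeight (suc a) 0) b (λ p → ℤ.*-zeroʳ (ind (suc b ℕ.≟ suc a)))) (gf-box-no-parts a b)

  gf-box-no-largest : ∀ l b → gf (boxWeight 0 (suc l)) b ≈ 0#
  gf-box-no-largest l zero = gf-nil₀ ≡.refl
  gf-box-no-largest l (suc b) =
    trans (gf-suc-const (boxWeight 0 (suc l)) b (λ _ → ≡.refl)) (gf-box-no-largest l b)

  -- Conjugation of partitions, at the level of generating functions.
  gf-box-comm : ∀ a l b → a ≤ b → l ≤ b → gf (boxWeight a l) b ≈ gf (boxWeight l a) b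
  gf-box-comm zero zero b _ _ = refl
  gf-box-comm zero (suc l) b _ _ = trans (gf-box-no-largest l b) (sym (gf-box-no-parts l b))
  gf-box-comm (suc a) zero b _ _ = trans (gf-box-no-parts a b) (sym (gf-box-no-largest a b))
  gf-box-comm (suc a) (suc l) b a<b l<b = begin
    gf (boxWeight (suc a) (suc l)) b          ≈⟨ closed a l a<b ⟩
    q ^ suc (a ℕ.+ l) * gauss a l
      ≈⟨ *-cong (^-congʳ q (≡.cong suc (ℕ.+-comm a l))) (gauss-comm a l) ⟩
    q ^ suc (l ℕ.+ a) * gauss l a             ≈⟨ closed l a l<b ⟨
    gf (boxWeight (suc l) (suc a)) b          ∎
    where
    closed : ∀ a l → suc a ≤ b → gf (boxWeight (suc a) (suc l)) b ≈ q ^ suc (a ℕ.+ l) * gauss a l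
    closed a l a<b =
      trans (reflexive (≡.cong (gf (boxWeight (suc a) (suc l))) (≡.sym (ℕ.m+[n∸m]≡n a<b)))) (gf-box a l (b ℕ.∸ suc a))

  -- The fourfold sum is spelled out with additions so that it passes to single coefficients without
  -- a convolution. The bounds are those at which `gf-smallest` and `gf-red` evaluate.
  weighted-identity :
    let S = Σ< n (λ m → gf (smallestWeight (suc m ℕ.* 2)) (suc m ℕ.* 2 ℕ.+ L) *
                        gf (redWeight (suc m)) ((suc m ℕ.+ suc m) ℕ.* 2 ℕ.+ L))
    in S + S + (S + S) + gf rankSignWeight L ≈ gf oneWeight L
  weighted-identity = begin
    Σ< n f + Σ< n f + (Σ< n f + Σ< n f) + gf rankSignWeight L
      ≈⟨ +-congʳ (solve 1 (λ S → S :+ S :+ (S :+ S) := (con 1 :+ con 1 :+ (con 1 :+ con 1)) :* S) refl (Σ< n f)) ⟩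
    4# * Σ< n f + gf rankSignWeight L    ≈⟨ +-cong (*-congˡ (Σ-cong n {f} {g} (λ m _ → f≈g m))) gf-rankSign ⟩
    4# * Σ< n g + β 0                    ≈⟨ q-identity ⟩
    r L                                  ≈⟨ gf-one L ⟨
    gf oneWeight L                       ∎
    where
    f g : ℕ → Carrier
    f m =
      gf (smallestWeight (suc m ℕ.* 2)) (suc m ℕ.* 2 ℕ.+ L) * gf (redWeight (suc m)) ((suc m ℕ.+ suc m) ℕ.* 2 ℕ.+ L)
    g m = q ^ (suc m ℕ.* 2) * y (suc m)
    f≈g : ∀ m → f m ≈ g m
    f≈g m = trans (*-cong (gf-smallest (suc (m ℕ.* 2))) (gf-red (suc m) L)) (*-assoc _ _ _)

open ≡ using (refl; cong; cong₂; sym; trans; subst)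
open RingSum ℤ.+-*-commutativeRing

-- Truncated power series

Series : Set
Series = ℕ → ℤ

tail : Series → Series
tail f k = f (suc k)

infixl 7 _⋆_
_⋆_ : Series → Series → Series
(f ⋆ g) k = Σ< (suc k) (λ i → f i ℤ.* g (k ∸ i))

one X : Series
one zero = 1ℤ
one (suc _) = 0ℤ
X zero = 0ℤ
X (suc k) = one k

⋆-cong : ∀ {f f′ g g′} k → (∀ i → i ≤ k → f i ≡ f′ i) → (∀ i → i ≤ k → g i ≡ g′ i) → (f ⋆ g) k ≡ (f′ ⋆ g′) k
⋆-cong k f≡f′ g≡g′ =
  Σ-cong (suc k) (λ { i (s≤s i≤k) → cong₂ ℤ._*_ (f≡f′ i i≤k) (g≡g′ (k ∸ i) (ℕ.m∸n≤m k i)) })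

⋆-distribʳ : ∀ f g h k → ((λ i → f i ℤ.+ g i) ⋆ h) k ≡ (f ⋆ h) k ℤ.+ (g ⋆ h) k
⋆-distribʳ f g h k = trans
  (Σ-cong (suc k) (λ i _ → ℤ.*-distribʳ-+ (h (k ∸ i)) (f i) (g i)))
  (Σ-+ (suc k) (λ i → f i ℤ.* h (k ∸ i)) (λ i → g i ℤ.* h (k ∸ i)))

⋆-scale : ∀ x f g k → ((λ i → x ℤ.* f i) ⋆ g) k ≡ x ℤ.* (f ⋆ g) k
⋆-scale x f g k = trans
  (Σ-cong (suc k) (λ i _ → ℤ.*-assoc x (f i) (g (k ∸ i))))
  (sym (*-distribˡ-Σ (suc k) x (λ i → f i ℤ.* g (k ∸ i))))

-- This peels off the last summand, where unfolding the definition peels off the first; the two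
-- together give `⋆-comm` by induction on the degree.
⋆-tailʳ : ∀ f g k → (f ⋆ g) (suc k) ≡ f (suc k) ℤ.* g 0 ℤ.+ (f ⋆ tail g) k
⋆-tailʳ f g zero = solve-∀′ (f 0 ℤ.* g 1) (f 1 ℤ.* g 0)
  where
  solve-∀′ : ∀ x y → x ℤ.+ (y ℤ.+ 0ℤ) ≡ y ℤ.+ (x ℤ.+ 0ℤ)
  solve-∀′ = solve-∀
⋆-tailʳ f g (suc k) = trans
  (cong (λ z → f 0 ℤ.* g (suc (suc k)) ℤ.+ z) (⋆-tailʳ (tail f) g k))
  (swap (f 0 ℤ.* g (suc (suc k))) (f (suc (suc k)) ℤ.* g 0) ((tail f ⋆ tail g) k))
  where
  swap : ∀ x y z → x ℤ.+ (y ℤ.+ z) ≡ y ℤ.+ (x ℤ.+ z)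
  swap = solve-∀

⋆-comm : ∀ f g k → (f ⋆ g) k ≡ (g ⋆ f) k
⋆-comm f g zero = cong (ℤ._+ 0ℤ) (ℤ.*-comm (f 0) (g 0))
⋆-comm f g (suc k) = trans
  (cong₂ ℤ._+_ (ℤ.*-comm (f 0) (g (suc k))) (⋆-comm (tail f) g k))
  (sym (⋆-tailʳ g f k))

-- Induction on the degree through tail(f ⋆ g) = f(0) · tail(g) + tail(f) ⋆ g.
⋆-assoc : ∀ f g h k → ((f ⋆ g) ⋆ h) k ≡ (f ⋆ (g ⋆ h)) k
⋆-assoc f g h zero = base (f 0) (g 0) (h 0)
  where
  base : ∀ x y z → (x ℤ.* y ℤ.+ 0ℤ) ℤ.* z ℤ.+ 0ℤ ≡ x ℤ.* (y ℤ.* z ℤ.+ 0ℤ) ℤ.+ 0ℤ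
  base = solve-∀
⋆-assoc f g h (suc k) = begin
  (f 0 ℤ.* g 0 ℤ.+ 0ℤ) ℤ.* h (suc k) ℤ.+ ((λ i → f 0 ℤ.* g (suc i) ℤ.+ (tail f ⋆ g) i) ⋆ h) k
    ≡⟨ cong (λ z → (f 0 ℤ.* g 0 ℤ.+ 0ℤ) ℤ.* h (suc k) ℤ.+ z)
         (trans (⋆-distribʳ (λ i → f 0 ℤ.* g (suc i)) (tail f ⋆ g) h k)
                  (cong₂ ℤ._+_ (⋆-scale (f 0) (tail g) h k) (⋆-assoc (tail f) g h k))) ⟩
  (f 0 ℤ.* g 0 ℤ.+ 0ℤ) ℤ.* h (suc k) ℤ.+ (f 0 ℤ.* (tail g ⋆ h) k ℤ.+ (tail f ⋆ (g ⋆ h)) k)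
    ≡⟨ regroup (f 0) (g 0) (h (suc k)) ((tail g ⋆ h) k) ((tail f ⋆ (g ⋆ h)) k) ⟩
  f 0 ℤ.* (g 0 ℤ.* h (suc k) ℤ.+ (tail g ⋆ h) k) ℤ.+ (tail f ⋆ (g ⋆ h)) k ∎
  where
  open ≡.≡-Reasoning
  regroup : ∀ a b c d e → (a ℤ.* b ℤ.+ 0ℤ) ℤ.* c ℤ.+ (a ℤ.* d ℤ.+ e) ≡ a ℤ.* (b ℤ.* c ℤ.+ d) ℤ.+ e
  regroup = solve-∀

⋆-zeroˡ : ∀ f k → ((λ _ → 0ℤ) ⋆ f) k ≡ 0ℤ
⋆-zeroˡ f k = Σ-zero (suc k) (λ i _ → ℤ.*-zeroˡ (f (k ∸ i)))

⋆-identityˡ : ∀ f k → (one ⋆ f) k ≡ f k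
⋆-identityˡ f zero = trans (ℤ.+-identityʳ _) (ℤ.*-identityˡ (f 0))
⋆-identityˡ f (suc k) = trans (cong₂ ℤ._+_ (ℤ.*-identityˡ (f (suc k))) (⋆-zeroˡ f k)) (ℤ.+-identityʳ _)

X⋆-zero : ∀ f → (X ⋆ f) 0 ≡ 0ℤ
X⋆-zero f = trans (ℤ.+-identityʳ (0ℤ ℤ.* f 0)) (ℤ.*-zeroˡ (f 0))

X⋆-suc : ∀ f k → (X ⋆ f) (suc k) ≡ f k
X⋆-suc f k = trans (cong₂ ℤ._+_ (ℤ.*-zeroˡ (f (suc k))) (⋆-identityˡ f k)) (ℤ.+-identityˡ _)

-- The quotient of ℤ[[X]] by X^K: sequences are kept whole and only equality is restricted, so the
-- operations do not depend on `K` and a coefficient below `K` is read off by application.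
truncatedSeries : ℕ → CommutativeRing 0ℓ 0ℓ
truncatedSeries K = record
  { Carrier = Series
  ; _≈_ = λ f g → ∀ k → k < K → f k ≡ g k
  ; _+_ = λ f g k → f k ℤ.+ g k
  ; _*_ = _⋆_
  ; -_ = λ f k → ℤ.- f k
  ; 0# = λ _ → 0ℤ
  ; 1# = one
  ; isCommutativeRing = record
    { isRing = record
      { +-isAbelianGroup = record
        { isGroup = record
          { isMonoid = record
            { isSemigroup = record
              { isMagma = record
                { isEquivalence = record
                  { refl = λ _ _ → refl
                  ; sym = λ p k k<K → sym (p k k<K)
                  ; trans = λ p p′ k k<K → trans (p k k<K) (p′ k k<K)
                  }
                ; ∙-cong = λ p p′ k k<K → cong₂ ℤ._+_ (p k k<K) (p′ k k<K)
                }
              ; assoc = λ f g h k _ → ℤ.+-assoc (f k) (g k) (h k)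
              }
            ; identity = (λ f k _ → ℤ.+-identityˡ (f k)) , (λ f k _ → ℤ.+-identityʳ (f k))
            }
          ; inverse = (λ f k _ → ℤ.+-inverseˡ (f k)) , (λ f k _ → ℤ.+-inverseʳ (f k))
          ; ⁻¹-cong = λ p k k<K → cong ℤ.-_ (p k k<K)
          }
        ; comm = λ f g k _ → ℤ.+-comm (f k) (g k)
        }
      ; *-cong =
        λ p p′ k k<K → ⋆-cong k (λ i i≤k → p i (ℕ.≤-<-trans i≤k k<K)) (λ i i≤k → p′ i (ℕ.≤-<-trans i≤k k<K))
      ; *-assoc = λ f g h k _ → ⋆-assoc f g h k
      ; *-identity = (λ f k _ → ⋆-identityˡ f k) , (λ f k _ → trans (⋆-comm f one k) (⋆-identityˡ f k))
      ; distrib =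
        (λ f g h k _ → trans (⋆-comm f (λ i → g i ℤ.+ h i) k) (trans (⋆-distribʳ g h f k) (cong₂ ℤ._+_ (⋆-comm g f k) (⋆-comm h f k))))
                , (λ f g h k _ → ⋆-distribʳ g h f k)
      }
    ; *-comm = λ f g k _ → ⋆-comm f g k
    }
  }

infixr 8 X^_
X^_ : ℕ → Series
X^ zero = one
X^ suc k = X ⋆ X^ k

X^⋆ : ∀ b f k → (X^ b ⋆ f) k ≡ (if b <ᵇ suc k then f (k ∸ b) else 0ℤ)
X^⋆ zero f k = ⋆-identityˡ f k
X^⋆ (suc b) f zero = trans (⋆-assoc X (X^ b) f 0) (X⋆-zero (X^ b ⋆ f))
X^⋆ (suc b) f (suc k) = trans (⋆-assoc X (X^ b) f (suc k)) (trans (X⋆-suc (X^ b ⋆ f) k) (X^⋆ b f k))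

<ᵇ-false : ∀ a d → (a ℕ.+ d <ᵇ a) ≡ false
<ᵇ-false zero d = refl
<ᵇ-false (suc a) d = <ᵇ-false a d

X^⋆-low : ∀ f k d → (X^ (suc k ℕ.+ d) ⋆ f) k ≡ 0ℤ
X^⋆-low f k d rewrite X^⋆ (suc k ℕ.+ d) f k | <ᵇ-false k d = refl

-- Sums over lists and the series of a weight

listSum : {A : Set} → (A → ℤ) → List A → ℤ
listSum w [] = 0ℤ
listSum w (x ∷ xs) = w x ℤ.+ listSum w xs

module _ {A : Set} where
  listSum-cong : ∀ {w w′ : A → ℤ} → (∀ x → w x ≡ w′ x) → ∀ xs → listSum w xs ≡ listSum w′ xs
  listSum-cong w≡w′ [] = refl
  listSum-cong w≡w′ (x ∷ xs) = cong₂ ℤ._+_ (w≡w′ x) (listSum-cong w≡w′ xs)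

  listSum-++ : ∀ (w : A → ℤ) xs ys → listSum w (xs ++ ys) ≡ listSum w xs ℤ.+ listSum w ys
  listSum-++ w [] ys = sym (ℤ.+-identityˡ _)
  listSum-++ w (x ∷ xs) ys = trans (cong (λ z → w x ℤ.+ z) (listSum-++ w xs ys)) (sym (ℤ.+-assoc (w x) _ _))

  listSum-+ : ∀ (w w′ : A → ℤ) xs → listSum (λ x → w x ℤ.+ w′ x) xs ≡ listSum w xs ℤ.+ listSum w′ xs
  listSum-+ w w′ [] = refl
  listSum-+ w w′ (x ∷ xs) =
    trans (cong (λ z → w x ℤ.+ w′ x ℤ.+ z) (listSum-+ w w′ xs)) (regroup (w x) (w′ x) _ _)
    where
    regroup : ∀ a b c d → a ℤ.+ b ℤ.+ (c ℤ.+ d) ≡ a ℤ.+ c ℤ.+ (b ℤ.+ d)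
    regroup = solve-∀

  listSum-*ˡ : ∀ x (w : A → ℤ) xs → listSum (λ y → x ℤ.* w y) xs ≡ x ℤ.* listSum w xs
  listSum-*ˡ x w [] = sym (ℤ.*-zeroʳ x)
  listSum-*ˡ x w (y ∷ xs) =
    trans (cong (λ z → x ℤ.* w y ℤ.+ z) (listSum-*ˡ x w xs)) (sym (ℤ.*-distribˡ-+ x (w y) _))

  listSum-zero : ∀ (xs : List A) → listSum (λ _ → 0ℤ) xs ≡ 0ℤ
  listSum-zero [] = refl
  listSum-zero (_ ∷ xs) = trans (ℤ.+-identityˡ _) (listSum-zero xs)

  listSum-Σ : ∀ n (w : ℕ → A → ℤ) xs → listSum (λ x → Σ< n (λ i → w i x)) xs ≡ Σ< n (λ i → listSum (w i) xs)
  listSum-Σ n w [] = sym (Σ-zero n (λ _ _ → refl))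
  listSum-Σ n w (x ∷ xs) =
    trans (cong (λ z → Σ< n (λ i → w i x) ℤ.+ z) (listSum-Σ n w xs)) (sym (Σ-+ n (λ i → w i x) (λ i → listSum (w i) xs)))

  listSum-filter : ∀ {P : Pred A 0ℓ} (P? : Decidable P) w xs → listSum w (filter P? xs) ≡ listSum (λ x → if does (P? x) then w x else 0ℤ) xs
  listSum-filter P? w [] = refl
  listSum-filter P? w (x ∷ xs) with does (P? x)
  ... | true = cong (λ z → w x ℤ.+ z) (listSum-filter P? w xs)
  ... | false = trans (listSum-filter P? w xs) (sym (ℤ.+-identityˡ _))

  length-filter : ∀ {P : Pred A 0ℓ} (P? : Decidable P) xs → ℤ.+ length (filter P? xs) ≡ listSum (λ x → ind (P? x)) xs
  length-filter P? [] = refl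
  length-filter P? (x ∷ xs) with does (P? x)
  ... | true = cong (λ z → 1ℤ ℤ.+ z) (length-filter P? xs)
  ... | false = trans (length-filter P? xs) (sym (ℤ.+-identityˡ _))

listSum-map : {A B : Set} (w : B → ℤ) (f : A → B) → ∀ xs → listSum w (map f xs) ≡ listSum (λ x → w (f x)) xs
listSum-map w f [] = refl
listSum-map w f (x ∷ xs) = cong (λ z → w (f x) ℤ.+ z) (listSum-map w f xs)

listSum-concatMap : {A B : Set} (w : B → ℤ) (f : A → List B) → ∀ xs → listSum w (concatMap f xs) ≡ listSum (λ x → listSum w (f x)) xs
listSum-concatMap w f [] = refl
listSum-concatMap w f (x ∷ xs) =
  trans (listSum-++ w (f x) (concatMap f xs)) (cong (λ z → listSum w (f x) ℤ.+ z) (listSum-concatMap w f xs))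

listSum-applyUpTo : {A : Set} (w : A → ℤ) (f : ℕ → A) → ∀ n → listSum w (applyUpTo f n) ≡ Σ< n (λ i → w (f i))
listSum-applyUpTo w f zero = refl
listSum-applyUpTo w f (suc n) = cong (λ z → w (f 0) ℤ.+ z) (listSum-applyUpTo w (λ i → f (suc i)) n)

partsGF : Weight → ℕ → Series
partsGF w b k = listSum w (partsLE b k)

-- `does (suc j ≤? b)` computes to `j <ᵇ b`, so this is the form that `listSum-filter` leaves
-- behind.
below : ℕ → (ℕ → ℤ) → ℕ → ℤ
below b h j = if j <ᵇ b then h j else 0ℤ

Σ-below-suc : ∀ N b h → Σ< N (below (suc b) h) ≡ Σ< N (below b h) ℤ.+ (if b <ᵇ N then h b else 0ℤ)
Σ-below-suc zero b h = refl
Σ-below-suc (suc N) zero h = swap (h 0) (Σ< N (λ _ → 0ℤ))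
  where
  swap : ∀ x y → x ℤ.+ y ≡ 0ℤ ℤ.+ y ℤ.+ x
  swap = solve-∀
Σ-below-suc (suc N) (suc b) h =
  trans (cong (λ z → h 0 ℤ.+ z) (Σ-below-suc N b (λ j → h (suc j)))) (sym (ℤ.+-assoc (h 0) _ _))

partsGF-coefficient : ∀ w b k → partsGF w b (suc k) ≡ Σ< (suc k) (below b (λ j → partsGF (λ p → w (suc j ∷ p)) (suc j) (k ∸ j)))
partsGF-coefficient w b k = begin
  listSum w (partsLE b (suc k))
    ≡⟨ cong (listSum w) (partsLE-suc b k) ⟩
  listSum w (concatMap parts (filter (λ j → suc j ≤? b) (upTo (suc k))))
    ≡⟨ listSum-concatMap w parts (filter (λ j → suc j ≤? b) (upTo (suc k))) ⟩
  listSum (λ j → listSum w (parts j)) (filter (λ j → suc j ≤? b) (upTo (suc k)))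
    ≡⟨ listSum-filter (λ j → suc j ≤? b) (λ j → listSum w (parts j)) (upTo (suc k)) ⟩
  listSum (below b (λ j → listSum w (parts j))) (upTo (suc k))
    ≡⟨ listSum-applyUpTo (below b (λ j → listSum w (parts j))) (λ j → j) (suc k) ⟩
  Σ< (suc k) (below b (λ j → listSum w (parts j)))
    ≡⟨ Σ-cong (suc k) (λ j _ → cong (λ x → if j <ᵇ b then x else 0ℤ) (listSum-map w (suc j ∷_) (partsLE (suc j) (k ∸ j)))) ⟩
  Σ< (suc k) (below b (λ j → partsGF (λ p → w (suc j ∷ p)) (suc j) (k ∸ j))) ∎
  where
  open ≡.≡-Reasoning
  parts : ℕ → List (List ℕ)
  parts j = map (suc j ∷_) (partsLE (suc j) (k ∸ j))

-- `partsGF-coefficient` sorts by the largest part, so a larger bound adds the single term of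
-- largest part b + 1; multiplying by the power of X is the corresponding shift of degree.
partsGF-suc : ∀ w b k → partsGF w (suc b) k ≡ partsGF w b k ℤ.+ (X^ suc b ⋆ partsGF (λ p → w (suc b ∷ p)) (suc b)) k
partsGF-suc w b zero =
  sym (trans (cong (λ z → w [] ℤ.+ 0ℤ ℤ.+ z) (X^⋆ (suc b) (partsGF (λ p → w (suc b ∷ p)) (suc b)) 0)) (ℤ.+-identityʳ _))
partsGF-suc w b (suc k) = begin
  partsGF w (suc b) (suc k)
    ≡⟨ partsGF-coefficient w (suc b) k ⟩
  Σ< (suc k) (below (suc b) h)
    ≡⟨ Σ-below-suc (suc k) b h ⟩
  Σ< (suc k) (below b h) ℤ.+ (if b <ᵇ suc k then h b else 0ℤ)
    ≡⟨ cong₂ ℤ._+_ (partsGF-coefficient w b k) (X^⋆ (suc b) (partsGF (λ p → w (suc b ∷ p)) (suc b)) (suc k)) ⟨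
  partsGF w b (suc k) ℤ.+ (X^ suc b ⋆ partsGF (λ p → w (suc b ∷ p)) (suc b)) (suc k) ∎
  where
  open ≡.≡-Reasoning
  h : ℕ → ℤ
  h j = partsGF (λ p → w (suc j ∷ p)) (suc j) (k ∸ j)

partsGF-zero : ∀ w k → partsGF w 0 k ≡ w [] ℤ.* one k
partsGF-zero w zero = trans (ℤ.+-identityʳ (w [])) (sym (ℤ.*-identityʳ (w [])))
partsGF-zero w (suc k) =
  trans (partsGF-coefficient w 0 k) (trans (Σ-zero (suc k) (λ _ _ → refl)) (sym (ℤ.*-zeroʳ (w []))))

partsGF∞ : Weight → Series
partsGF∞ w k = partsGF w k k

partsGF-stable : ∀ w k d → partsGF w (k ℕ.+ d) k ≡ partsGF∞ w k
partsGF-stable w k zero = cong (λ b → partsGF w b k) (ℕ.+-identityʳ k)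
partsGF-stable w k (suc d) rewrite ℕ.+-suc k d = trans (partsGF-suc w (k ℕ.+ d) k)
  (trans (cong₂ ℤ._+_ (partsGF-stable w k d) (X^⋆-low (partsGF (λ p → w (suc (k ℕ.+ d) ∷ p)) (suc (k ℕ.+ d))) k d)) (ℤ.+-identityʳ _))

-- `N` is the structurally decreasing argument, because the recursion passes from `suc n` to
-- `n ∸ k`.
partsLE-All : ∀ {Q : List ℕ → ℕ → Set} → Q [] 0 → (∀ k m p → Q p m → Q (suc k ∷ p) (suc k ℕ.+ m)) →
  ∀ N b n → n ≤ N → All (λ p → Q p n) (partsLE b n)
partsLE-All base step N b zero _ = base ∷ []
partsLE-All {Q} base step (suc N) b (suc n) (s≤s n≤N) rewrite partsLE-suc b n =
  All.concat⁺ (All.map⁺ (All.filter⁺ (λ k → suc k ℕ.≤? b) (All.applyUpTo⁺₁ (λ k → k) (suc n)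
    (λ { {k} (s≤s k≤n) → All.map⁺ (All.map
      (λ {p} Qp → subst (Q (suc k ∷ p)) (cong suc (ℕ.m+[n∸m]≡n k≤n)) (step k (n ∸ k) p Qp))
      (partsLE-All {Q} base step N (suc k) (n ∸ k) (ℕ.≤-trans (ℕ.m∸n≤m n k) n≤N))) }))))

Bounded : List ℕ → ℕ → Set
Bounded p n = largest p ≤ n × length p ≤ n × smallest p ≤ n

partitions-bounded : ∀ n → All (λ p → Bounded p n) (partitions n)
partitions-bounded n = partsLE-All {Bounded} (z≤n , z≤n , z≤n) step n n n ℕ.≤-refl
  where
  step : ∀ k m p → Bounded p m → Bounded (suc k ∷ p) (suc k ℕ.+ m)
  step k m [] _ = ℕ.m≤m+n (suc k) m , s≤s z≤n , ℕ.m≤m+n (suc k) m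
  step k m (x ∷ p) (_ , len≤m , small≤m) =
    ℕ.m≤m+n (suc k) m , s≤s (ℕ.≤-trans len≤m (ℕ.m≤n+m m k)) , ℕ.≤-trans small≤m (ℕ.m≤n+m m (suc k))

listSum-cong-All : {A : Set} {w w′ : A → ℤ} {xs : List A} → All (λ x → w x ≡ w′ x) xs → listSum w xs ≡ listSum w′ xs
listSum-cong-All [] = refl
listSum-cong-All (eq ∷ eqs) = cong₂ ℤ._+_ eq (listSum-cong-All eqs)

-- Counting

Σ-δ : ∀ N k (h : ℕ → ℤ) → k < N → Σ< N (λ i → h i ℤ.* ind (k ℕ.≟ i)) ≡ h k
Σ-δ (suc N) zero h _ = trans
  (cong₂ ℤ._+_ (ℤ.*-identityʳ (h 0)) (Σ-zero N (λ i _ → ℤ.*-zeroʳ (h (suc i)))))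
  (ℤ.+-identityʳ (h 0))
Σ-δ (suc N) (suc k) h (s≤s k<N) = trans
  (cong₂ ℤ._+_ (ℤ.*-zeroʳ (h 0)) (Σ-δ N k (λ i → h (suc i)) k<N))
  (ℤ.+-identityˡ (h (suc k)))

oddExcess : ℕ → ℕ → ℤ
oddExcess a l = ind ((l ℕ.<? a) ×-dec ((a ∸ l) % 2 ℕ.≟ 1))

parity-sgn : ∀ a → 1ℤ ≡ (ind (a % 2 ℕ.≟ 1) ℤ.+ ind (a % 2 ℕ.≟ 1)) ℤ.+ sgn a
parity-sgn zero = refl
parity-sgn (suc zero) = refl
parity-sgn (suc (suc a)) = trans (parity-sgn a)
  (cong (λ z → (ind (a % 2 ℕ.≟ 1) ℤ.+ ind (a % 2 ℕ.≟ 1)) ℤ.+ z) (sym (ℤ.neg-involutive (sgn a))))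

-- 1 - (-1)^(a-l) is 2 exactly when the difference is odd, and an odd difference counts in exactly
-- one of the two orders. Lowering both arguments by 1 changes nothing, since the two sign changes
-- cancel.
oddExcess-sgn : ∀ a l → 1ℤ ≡ (oddExcess a l ℤ.+ oddExcess a l) ℤ.+ (oddExcess l a ℤ.+ oddExcess l a) ℤ.+ sgn a ℤ.* sgn l
oddExcess-sgn zero zero = refl
oddExcess-sgn (suc a) zero = trans (parity-sgn (suc a)) (regroup (ind (suc a % 2 ℕ.≟ 1)) (sgn (suc a)))
  where
  regroup : ∀ x s → (x ℤ.+ x) ℤ.+ s ≡ (x ℤ.+ x) ℤ.+ 0ℤ ℤ.+ s ℤ.* 1ℤ
  regroup = solve-∀
oddExcess-sgn zero (suc l) = trans (parity-sgn (suc l)) (regroup (ind (suc l % 2 ℕ.≟ 1)) (sgn (suc l)))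
  where
  regroup : ∀ x s → (x ℤ.+ x) ℤ.+ s ≡ 0ℤ ℤ.+ (x ℤ.+ x) ℤ.+ 1ℤ ℤ.* s
  regroup = solve-∀
oddExcess-sgn (suc a) (suc l) = trans (oddExcess-sgn a l)
  (cong (λ z → (oddExcess a l ℤ.+ oddExcess a l) ℤ.+ (oddExcess l a ℤ.+ oddExcess l a) ℤ.+ z) (neg*neg (sgn a) (sgn l)))
  where
  neg*neg : ∀ x y → x ℤ.* y ≡ (ℤ.- x) ℤ.* (ℤ.- y)
  neg*neg = solve-∀

ind-⇔ : {P Q : Set} (d : Dec P) (d′ : Dec Q) → (P → Q) → (Q → P) → ind d ≡ ind d′
ind-⇔ (yes p) d′ f g = sym (ind-yes d′ (f p))
ind-⇔ (no ¬p) d′ f g = sym (ind-no d′ (λ z → ¬p (g z)))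

smallest-large : ∀ k x p → All (k <_) (x ∷ p) → k < smallest (x ∷ p)
smallest-large k x [] (k<x ∷ []) = k<x
smallest-large k x (y ∷ p) (_ ∷ k<p) = smallest-large k y p k<p

red-large : ∀ m {p} → All (RedPart m) p → All (2 ℕ.* m <_) p
red-large m = All.map (λ { (_ , 2m<x , _) → 2m<x })

-- Every red part exceeds 2m, so the smallest part can only be blue. This separates the condition
-- into one on each colour and makes the count a product.
gCond⇒smallest-blue : ∀ m blue red → smallest2 (blue , red) ≡ 2 ℕ.* suc m → All (RedPart (suc m)) red →
  smallest blue ≡ 2 ℕ.* suc m
gCond⇒smallest-blue m [] [] () all
gCond⇒smallest-blue m [] (x ∷ red) eq all =
  ⊥-elim (ℕ.<⇒≢ (smallest-large _ x red (red-large (suc m) all)) (sym eq))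
gCond⇒smallest-blue m (_ ∷ _) [] eq all = eq
gCond⇒smallest-blue m (b ∷ blue) (x ∷ red) eq all with ℕ.⊓-sel (smallest (b ∷ blue)) (smallest (x ∷ red))
... | inj₁ ⊓≡blue = trans (sym ⊓≡blue) eq
... | inj₂ ⊓≡red =
  ⊥-elim (ℕ.<⇒≢ (smallest-large _ x red (red-large (suc m) all)) (sym (trans (sym ⊓≡red) eq)))

smallest-blue⇒smallest2 : ∀ m blue red → smallest blue ≡ 2 ℕ.* suc m → All (RedPart (suc m)) red →
  smallest2 (blue , red) ≡ 2 ℕ.* suc m
smallest-blue⇒smallest2 m (_ ∷ _) [] eq all = eq
smallest-blue⇒smallest2 m (b ∷ blue) (x ∷ red) eq all = trans
  (ℕ.m≤n⇒m⊓n≡m (ℕ.≤-trans (ℕ.≤-reflexive eq) (ℕ.<⇒≤ (smallest-large _ x red (red-large (suc m) all))))) eq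

-- The existential over m becomes a sum: the smallest blue part determines m, so at most one term is
-- nonzero.
ind-gCond : ∀ n blue red → smallest blue ≤ n →
  ind (gCond? (blue , red)) ≡ Σ< n (λ m → redWeight (suc m) red ℤ.* smallestWeight (suc m ℕ.* 2) blue)
ind-gCond n blue red small≤n = helper (gCond? (blue , red))
  where
  Terms : Set
  Terms = ind (gCond? (blue , red)) ≡ Σ< n (λ m → redWeight (suc m) red ℤ.* smallestWeight (suc m ℕ.* 2) blue)
  helper : Dec (GCond (blue , red)) → Terms
  helper (yes g@(suc k , _ , eq , all)) = begin
    ind (gCond? (blue , red))
      ≡⟨ ind-yes (gCond? (blue , red)) g ⟩
    1ℤ
      ≡⟨ ind-yes (all? (redPart? (suc k)) red) all ⟨
    redWeight (suc k) red
      -- The index is in range because 2(k + 1) is the smallest blue part, hence at most n.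
      ≡⟨ Σ-δ n k (λ m → redWeight (suc m) red) (ℕ.≤-trans (ℕ.m≤m*n (suc k) 2) (subst (_≤ n) small small≤n)) ⟨
    Σ< n (λ m → redWeight (suc m) red ℤ.* ind (k ℕ.≟ m))
      ≡⟨ Σ-cong n (λ m _ → cong (redWeight (suc m) red ℤ.*_) (ind-⇔ (k ℕ.≟ m) (smallest blue ℕ.≟ suc m ℕ.* 2)
           (λ k≡m → trans small (cong (λ j → suc j ℕ.* 2) k≡m))
           (λ eq′ → ℕ.suc-injective (ℕ.*-cancelʳ-≡ (suc k) (suc m) 2 (trans (sym small) eq′))))) ⟩
    Σ< n (λ m → redWeight (suc m) red ℤ.* smallestWeight (suc m ℕ.* 2) blue) ∎
    where
    open ≡.≡-Reasoning
    small : smallest blue ≡ suc k ℕ.* 2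
    small = trans (gCond⇒smallest-blue k blue red eq all) (ℕ.*-comm 2 (suc k))
  helper (no ¬g) = trans (ind-no (gCond? (blue , red)) ¬g) (sym (Σ-zero n (λ m _ → term≡0 m)))
    where
    term≡0 : ∀ m → redWeight (suc m) red ℤ.* smallestWeight (suc m ℕ.* 2) blue ≡ 0ℤ
    term≡0 m = by-cases (smallest blue ℕ.≟ suc m ℕ.* 2) (all? (redPart? (suc m)) red)
      where
      by-cases : (d : Dec (smallest blue ≡ suc m ℕ.* 2)) (d′ : Dec (All (RedPart (suc m)) red)) → ind d′ ℤ.* ind d ≡ 0ℤ
      by-cases (no _) d′ = ℤ.*-zeroʳ (ind d′)
      by-cases (yes _) (no _) = refl
      by-cases (yes small) (yes all) = ⊥-elim (¬g (suc m , s≤s z≤n ,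
        smallest-blue⇒smallest2 m blue red (trans small (ℕ.*-comm (suc m) 2)) all , all))

X^≡^ : ∀ K k → X^ k ≡ Exp._^_ (CommutativeRing.commutativeSemiring (truncatedSeries K)) X k
X^≡^ K zero = refl
X^≡^ K (suc k) = cong (X ⋆_) (X^≡^ K k)

X-nilpotent : ∀ K → CommutativeRing._≈_ (truncatedSeries K) (Exp._^_ (CommutativeRing.commutativeSemiring (truncatedSeries K)) X K) (λ _ → 0ℤ)
X-nilpotent K k k<K rewrite sym (X^≡^ K K) = begin
  (X^ K) k                                  ≡⟨ ⋆-identityˡ (X^ K) k ⟨
  (one ⋆ X^ K) k                            ≡⟨ ⋆-comm one (X^ K) k ⟩
  (X^ K ⋆ one) k                            ≡⟨ cong (λ j → (X^ j ⋆ one) k) (ℕ.m+[n∸m]≡n k<K) ⟨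
  (X^ (suc k ℕ.+ (K ∸ suc k)) ⋆ one) k      ≡⟨ X^⋆-low one k (K ∸ suc k) ⟩
  0ℤ                                        ∎
  where open ≡.≡-Reasoning

partsGF-isGeneratingFunction : ∀ K → IsGeneratingFunction (truncatedSeries K) X partsGF
partsGF-isGeneratingFunction K = record
  { gf-cong = λ w≡w′ b k _ → listSum-cong w≡w′ (partsLE b k)
  ; gf-0 = λ b k _ → listSum-zero (partsLE b k)
  ; gf-+ = λ w w′ b k _ → listSum-+ w w′ (partsLE b k)
  ; gf-neg = λ w b k _ → trans
      (listSum-cong (λ p → sym (ℤ.-1*i≡-i (w p))) (partsLE b k))
      (trans (listSum-*ˡ ℤ.-1ℤ w (partsLE b k)) (ℤ.-1*i≡-i (partsGF w b k)))
  ; gf-nil₀ = λ {w} w[]≡0 k _ → trans (partsGF-zero w k) (trans (cong (ℤ._* one k) w[]≡0) (ℤ.*-zeroˡ (one k)))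
  ; gf-nil₁ =
    λ {w} w[]≡1 k _ → trans (partsGF-zero w k) (trans (cong (ℤ._* one k) w[]≡1) (ℤ.*-identityˡ (one k)))
  ; gf-suc = λ w b k _ → trans (partsGF-suc w b k)
      (cong (λ x → partsGF w b k ℤ.+ (x ⋆ partsGF (λ p → w (suc b ∷ p)) (suc b)) k) (X^≡^ K (suc b)))
  }

Σ-coefficient : ∀ K N (F : ℕ → Series) k → RingSum.Σ< (truncatedSeries K) N F k ≡ Σ< N (λ m → F m k)
Σ-coefficient K zero F k = refl
Σ-coefficient K (suc N) F k = cong (λ z → F 0 k ℤ.+ z) (Σ-coefficient K N (λ m → F (suc m)) k)

module _ (n : ℕ) where
  private
    K : ℕ
    K = suc (n ℕ.* 2)
    open WeightedCounts (truncatedSeries K) X n (X-nilpotent K) partsGF (partsGF-isGeneratingFunction K)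
      using (weighted-identity; gf-box-comm)
    n<K : n < K
    n<K = s≤s (ℕ.m≤m*n n 2)

  -- The red series comes first so that the convolution index is the red total, as in `twoColour`.
  gPairs : ℤ
  gPairs = Σ< n (λ m → (partsGF∞ (redWeight (suc m)) ⋆ partsGF∞ (smallestWeight (suc m ℕ.* 2))) n)

  G≡gPairs : ℤ.+ G n ≡ gPairs
  G≡gPairs = begin
    ℤ.+ G n
      ≡⟨ length-filter gCond? (twoColour n) ⟩
    listSum (λ x → ind (gCond? x)) (twoColour n)
      ≡⟨ listSum-concatMap (λ x → ind (gCond? x)) (λ r → concatMap (pairs r) (partitions r)) (upTo (suc n)) ⟩
    listSum (λ r → listSum (λ x → ind (gCond? x)) (concatMap (pairs r) (partitions r))) (upTo (suc n))
      ≡⟨ listSum-applyUpTo (λ r → listSum (λ x → ind (gCond? x)) (concatMap (pairs r) (partitions r))) (λ r → r) (suc n) ⟩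
    Σ< (suc n) (λ r → listSum (λ x → ind (gCond? x)) (concatMap (pairs r) (partitions r)))
      ≡⟨ Σ-cong (suc n) (λ r _ → perTotal r) ⟩
    Σ< (suc n) (λ r → Σ< n (λ m → partsGF∞ (redWeight (suc m)) r ℤ.* partsGF∞ (smallestWeight (suc m ℕ.* 2)) (n ∸ r)))
      ≡⟨ Σ-swap (suc n) n (λ r m → partsGF∞ (redWeight (suc m)) r ℤ.* partsGF∞ (smallestWeight (suc m ℕ.* 2)) (n ∸ r)) ⟩
    gPairs ∎
    where
    open ≡.≡-Reasoning
    pairs : ℕ → List ℕ → List (List ℕ × List ℕ)
    pairs r red = map (λ blue → blue , red) (partitions (n ∸ r))
    perRed : ∀ r red → listSum (λ x → ind (gCond? x)) (pairs r red) ≡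
      Σ< n (λ m → partsGF∞ (smallestWeight (suc m ℕ.* 2)) (n ∸ r) ℤ.* redWeight (suc m) red)
    perRed r red = begin
      listSum (λ x → ind (gCond? x)) (pairs r red)
        ≡⟨ listSum-map (λ x → ind (gCond? x)) (λ blue → blue , red) (partitions (n ∸ r)) ⟩
      listSum (λ blue → ind (gCond? (blue , red))) (partitions (n ∸ r))
        ≡⟨ listSum-cong-All (All.map (λ {blue} bounded → ind-gCond n blue red (ℕ.≤-trans (proj₂ (proj₂ bounded)) (ℕ.m∸n≤m n r))) (partitions-bounded (n ∸ r))) ⟩
      listSum (λ blue → Σ< n (λ m → redWeight (suc m) red ℤ.* smallestWeight (suc m ℕ.* 2) blue)) (partitions (n ∸ r))
        ≡⟨ listSum-Σ n (λ m blue → redWeight (suc m) red ℤ.* smallestWeight (suc m ℕ.* 2) blue) (partitions (n ∸ r)) ⟩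
      Σ< n (λ m → listSum (λ blue → redWeight (suc m) red ℤ.* smallestWeight (suc m ℕ.* 2) blue) (partitions (n ∸ r)))
        ≡⟨ Σ-cong n (λ m _ → trans (listSum-*ˡ (redWeight (suc m) red) (smallestWeight (suc m ℕ.* 2)) (partitions (n ∸ r))) (ℤ.*-comm (redWeight (suc m) red) (partsGF∞ (smallestWeight (suc m ℕ.* 2)) (n ∸ r)))) ⟩
      Σ< n (λ m → partsGF∞ (smallestWeight (suc m ℕ.* 2)) (n ∸ r) ℤ.* redWeight (suc m) red) ∎
    perTotal : ∀ r → listSum (λ x → ind (gCond? x)) (concatMap (pairs r) (partitions r)) ≡
      Σ< n (λ m → partsGF∞ (redWeight (suc m)) r ℤ.* partsGF∞ (smallestWeight (suc m ℕ.* 2)) (n ∸ r))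
    perTotal r = begin
      listSum (λ x → ind (gCond? x)) (concatMap (pairs r) (partitions r))
        ≡⟨ listSum-concatMap (λ x → ind (gCond? x)) (pairs r) (partitions r) ⟩
      listSum (λ red → listSum (λ x → ind (gCond? x)) (pairs r red)) (partitions r)
        ≡⟨ listSum-cong (perRed r) (partitions r) ⟩
      listSum (λ red → Σ< n (λ m → blueTotal m ℤ.* redWeight (suc m) red)) (partitions r)
        ≡⟨ listSum-Σ n (λ m red → blueTotal m ℤ.* redWeight (suc m) red) (partitions r) ⟩
      Σ< n (λ m → listSum (λ red → blueTotal m ℤ.* redWeight (suc m) red) (partitions r))
        ≡⟨ Σ-cong n (λ m _ → trans (listSum-*ˡ (blueTotal m) (redWeight (suc m)) (partitions r)) (ℤ.*-comm (blueTotal m) (partsGF∞ (redWeight (suc m)) r))) ⟩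
      Σ< n (λ m → partsGF∞ (redWeight (suc m)) r ℤ.* blueTotal m) ∎
      where
      blueTotal : ℕ → ℤ
      blueTotal m = partsGF∞ (smallestWeight (suc m ℕ.* 2)) (n ∸ r)

  stable : ∀ w k b → k ≤ b → partsGF w b k ≡ partsGF∞ w k
  stable w k b k≤b = trans (cong (λ j → partsGF w j k) (sym (ℕ.m+[n∸m]≡n k≤b))) (partsGF-stable w k (b ∸ k))

  gPairs-identity : gPairs ℤ.+ gPairs ℤ.+ (gPairs ℤ.+ gPairs) ℤ.+ partsGF∞ rankSignWeight n ≡ partsGF∞ oneWeight n
  gPairs-identity = begin
    gPairs ℤ.+ gPairs ℤ.+ (gPairs ℤ.+ gPairs) ℤ.+ partsGF∞ rankSignWeight n
      ≡⟨ cong₂ (λ s t → s ℤ.+ s ℤ.+ (s ℤ.+ s) ℤ.+ t) total (stable rankSignWeight n L n≤L) ⟨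
    S n ℤ.+ S n ℤ.+ (S n ℤ.+ S n) ℤ.+ partsGF rankSignWeight L n
      ≡⟨ weighted-identity n n<K ⟩
    partsGF oneWeight L n
      ≡⟨ stable oneWeight n L n≤L ⟩
    partsGF∞ oneWeight n ∎
    where
    open ≡.≡-Reasoning
    L : ℕ
    L = n ℕ.* 2
    n≤L : n ≤ L
    n≤L = ℕ.m≤m*n n 2
    blue red : ℕ → Series
    blue m = partsGF (smallestWeight (suc m ℕ.* 2)) (suc m ℕ.* 2 ℕ.+ L)
    red m = partsGF (redWeight (suc m)) ((suc m ℕ.+ suc m) ℕ.* 2 ℕ.+ L)
    S : Series
    S = RingSum.Σ< (truncatedSeries K) n (λ m → blue m ⋆ red m)
    product : ∀ m → (blue m ⋆ red m) n ≡ (partsGF∞ (redWeight (suc m)) ⋆ partsGF∞ (smallestWeight (suc m ℕ.* 2))) n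
    product m = trans (⋆-comm (blue m) (red m) n) (⋆-cong n
      (λ i i≤n → stable (redWeight (suc m)) i ((suc m ℕ.+ suc m) ℕ.* 2 ℕ.+ L) (ℕ.≤-trans i≤n (ℕ.≤-trans n≤L (ℕ.m≤n+m L ((suc m ℕ.+ suc m) ℕ.* 2)))))
      (λ i i≤n → stable (smallestWeight (suc m ℕ.* 2)) i (suc m ℕ.* 2 ℕ.+ L) (ℕ.≤-trans i≤n (ℕ.≤-trans n≤L (ℕ.m≤n+m L (suc m ℕ.* 2))))))
    total : S n ≡ gPairs
    total = trans (Σ-coefficient K n (λ m → blue m ⋆ red m) n) (Σ-cong n (λ m _ → product m))

  by-boxes : ∀ (φ : ℕ → ℕ → ℤ) p → Bounded p n →
    φ (largest p) (length p) ≡ Σ< (suc n) (λ a → Σ< (suc n) (λ l → φ a l ℤ.* boxWeight a l p))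
  by-boxes φ p (la≤n , le≤n , _) = sym (begin
    Σ< (suc n) (λ a → Σ< (suc n) (λ l → φ a l ℤ.* boxWeight a l p))
      ≡⟨ Σ-cong (suc n) (λ a _ → Σ-cong (suc n) (λ l _ → sym (ℤ.*-assoc (φ a l) (isLargest a) (lengthWeight l p)))) ⟩
    Σ< (suc n) (λ a → Σ< (suc n) (λ l → φ a l ℤ.* isLargest a ℤ.* lengthWeight l p))
      ≡⟨ Σ-cong (suc n) (λ a _ → Σ-δ (suc n) (length p) (λ l → φ a l ℤ.* isLargest a) (s≤s le≤n)) ⟩
    Σ< (suc n) (λ a → φ a (length p) ℤ.* isLargest a)
      ≡⟨ Σ-δ (suc n) (largest p) (λ a → φ a (length p)) (s≤s la≤n) ⟩
    φ (largest p) (length p) ∎)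
    where
    open ≡.≡-Reasoning
    isLargest : ℕ → ℤ
    isLargest a = ind (largest p ℕ.≟ a)

  sum-by-boxes : ∀ (φ : ℕ → ℕ → ℤ) → listSum (λ p → φ (largest p) (length p)) (partitions n) ≡
    Σ< (suc n) (λ a → Σ< (suc n) (λ l → φ a l ℤ.* partsGF∞ (boxWeight a l) n))
  sum-by-boxes φ = begin
    listSum (λ p → φ (largest p) (length p)) (partitions n)
      ≡⟨ listSum-cong-All (All.map (λ {p} → by-boxes φ p) (partitions-bounded n)) ⟩
    listSum (λ p → Σ< (suc n) (λ a → Σ< (suc n) (λ l → φ a l ℤ.* boxWeight a l p))) (partitions n)
      ≡⟨ listSum-Σ (suc n) (λ a p → Σ< (suc n) (λ l → φ a l ℤ.* boxWeight a l p)) (partitions n) ⟩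
    Σ< (suc n) (λ a → listSum (λ p → Σ< (suc n) (λ l → φ a l ℤ.* boxWeight a l p)) (partitions n))
      ≡⟨ Σ-cong (suc n) (λ a _ → listSum-Σ (suc n) (λ l p → φ a l ℤ.* boxWeight a l p) (partitions n)) ⟩
    Σ< (suc n) (λ a → Σ< (suc n) (λ l → listSum (λ p → φ a l ℤ.* boxWeight a l p) (partitions n)))
      ≡⟨ Σ-cong (suc n) (λ a _ → Σ-cong (suc n) (λ l _ → listSum-*ˡ (φ a l) (boxWeight a l) (partitions n))) ⟩
    Σ< (suc n) (λ a → Σ< (suc n) (λ l → φ a l ℤ.* partsGF∞ (boxWeight a l) n)) ∎
    where open ≡.≡-Reasoning

  -- Conjugation without a bijection: split by largest part and length, exchange the two sums, and
  -- use the symmetry of box counts. Ranges up to n cover every partition of n and meet the bounds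
  -- of `gf-box-comm`.
  largest↔length : ∀ (φ : ℕ → ℕ → ℤ) →
    listSum (λ p → φ (largest p) (length p)) (partitions n) ≡ listSum (λ p → φ (length p) (largest p)) (partitions n)
  largest↔length φ = begin
    listSum (λ p → φ (largest p) (length p)) (partitions n)
      ≡⟨ sum-by-boxes φ ⟩
    Σ< (suc n) (λ a → Σ< (suc n) (λ l → φ a l ℤ.* partsGF∞ (boxWeight a l) n))
      ≡⟨ Σ-swap (suc n) (suc n) (λ a l → φ a l ℤ.* partsGF∞ (boxWeight a l) n) ⟩
    Σ< (suc n) (λ l → Σ< (suc n) (λ a → φ a l ℤ.* partsGF∞ (boxWeight a l) n))
      ≡⟨ Σ-cong (suc n) (λ { l (s≤s l≤n) → Σ-cong (suc n) (λ { a (s≤s a≤n) → cong (φ a l ℤ.*_) (gf-box-comm a l n a≤n l≤n n n<K) }) }) ⟩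
    Σ< (suc n) (λ l → Σ< (suc n) (λ a → φ a l ℤ.* partsGF∞ (boxWeight l a) n))
      ≡⟨ sum-by-boxes (λ l a → φ a l) ⟨
    listSum (λ p → φ (length p) (largest p)) (partitions n) ∎
    where open ≡.≡-Reasoning

  -- Each partition is weighted by `oddExcess-sgn`; the sum over negative odd ranks is again `N` by
  -- `largest↔length`.
  NoPlus-identity : let N = ℤ.+ NoPlus n in
    partsGF∞ oneWeight n ≡ N ℤ.+ N ℤ.+ (N ℤ.+ N) ℤ.+ partsGF∞ rankSignWeight n
  NoPlus-identity = begin
    partsGF∞ oneWeight n
      ≡⟨ listSum-cong (λ p → oddExcess-sgn (largest p) (length p)) (partitions n) ⟩
    listSum (λ p → (pos p ℤ.+ pos p) ℤ.+ (neg p ℤ.+ neg p) ℤ.+ rankSignWeight p) (partitions n)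
      ≡⟨ trans (listSum-+ (λ p → (pos p ℤ.+ pos p) ℤ.+ (neg p ℤ.+ neg p)) rankSignWeight (partitions n))
           (cong (λ z → z ℤ.+ partsGF∞ rankSignWeight n)
             (trans (listSum-+ (λ p → pos p ℤ.+ pos p) (λ p → neg p ℤ.+ neg p) (partitions n))
               (cong₂ ℤ._+_ (listSum-+ pos pos (partitions n)) (listSum-+ neg neg (partitions n))))) ⟩
    (Σpos ℤ.+ Σpos) ℤ.+ (Σneg ℤ.+ Σneg) ℤ.+ partsGF∞ rankSignWeight n
      ≡⟨ cong₂ (λ x y → (x ℤ.+ x) ℤ.+ (y ℤ.+ y) ℤ.+ partsGF∞ rankSignWeight n) (sym count) (trans (sym (largest↔length oddExcess)) (sym count)) ⟩
    (N ℤ.+ N) ℤ.+ (N ℤ.+ N) ℤ.+ partsGF∞ rankSignWeight n ∎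
    where
    open ≡.≡-Reasoning
    pos neg : Weight
    pos p = oddExcess (largest p) (length p)
    neg p = oddExcess (length p) (largest p)
    N Σpos Σneg : ℤ
    N = ℤ.+ NoPlus n
    Σpos = listSum pos (partitions n)
    Σneg = listSum neg (partitions n)
    count : N ≡ Σpos
    count = length-filter posOddRank? (partitions n)

quadruple-injective : ∀ x y z → x ℤ.+ x ℤ.+ (x ℤ.+ x) ℤ.+ z ≡ y ℤ.+ y ℤ.+ (y ℤ.+ y) ℤ.+ z → x ≡ y
quadruple-injective x y z eq =
  ℤ.*-cancelʳ-≡ x y (ℤ.+ 4) (trans (sym (quadruple x)) (trans (RingProperties.+-cancelʳ ℤ.+-*-ring z (x ℤ.+ x ℤ.+ (x ℤ.+ x)) (y ℤ.+ y ℤ.+ (y ℤ.+ y)) eq) (quadruple y)))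
  where
  quadruple : ∀ x → x ℤ.+ x ℤ.+ (x ℤ.+ x) ≡ x ℤ.* ℤ.+ 4
  quadruple = solve-∀

theorem1p2 : (n : ℕ) → 1 ≤ n → NoPlus n ≡ G n
theorem1p2 n _ = ℤ.+-injective (trans
  (quadruple-injective (ℤ.+ NoPlus n) (gPairs n) (partsGF∞ rankSignWeight n)
    (trans (sym (NoPlus-identity n)) (sym (gPairs-identity n))))
  (sym (G≡gPairs n)))
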